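{- Let $f(x),g(x)\in\mathbb{Z}[x]$ be polynomials of positive degree having no common complex root, let $m=\deg(f)$, $n=\deg(g)$, and $d=\gcd(L(f),L(g))$. Let $p,q\in\mathbb{Z}[x]$ be any polynomials with $p(x)f(x)+q(x)g(x)=r(f,g)$, and let $j=\deg(pf)=\deg(qg)$. Then $$R(f,g)\mid d^{j}\, r(f,g)^{\max(m,n)}.$$ Moreover, if both $f$ and $g$ are monic, then $R(f,g)\mid r(f,g)^{\min(m,n)}$.
   Context: $L(h)$ denotes the leading coefficient of $h\in\mathbb{Z}[x]$. $R(f,g)=|\mathrm{Res}(f,g)|$, the absolute value of the resultant of $f$ and $g$. $r(f,g)$ is the smallest positive integer in the set $\{p(x)f(x)+q(x)g(x): p,q\in\mathbb{Z}[x]\}$. -}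

module Defs where

open import Data.Bool using (Bool; true; false; if_then_else_; _∧_)
open import Data.Nat as ℕ using (ℕ; zero; suc; _∸_; _≤ᵇ_; _<ᵇ_)
open import Data.Nat.GCD using (gcd)
open import Data.Integer as ℤ using (ℤ; +_; -_; ∣_∣)
open import Data.Fin using (Fin; toℕ; punchIn)
import Data.Fin as Fin
open import Data.List using (List; []; _∷_; map)
open import Data.Product using (Σ; _×_; ∃₂)
open import Relation.Binary.PropositionalEquality using (_≡_)

-- Polynomials in ℤ[x], represented as coefficient lists in ascending
-- order of powers:  a₀ ∷ a₁ ∷ … ∷ aₖ ∷ []  represents  a₀ + a₁x + … + aₖxᵏ.
-- Trailing zero coefficients are allowed; two lists represent the same
-- polynomial iff they have the same coefficient sequence (see _≈ₚ_).

Poly : Set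
Poly = List ℤ

coeff : Poly → ℕ → ℤ
coeff []       _       = + 0
coeff (a ∷ p)  zero    = a
coeff (a ∷ p)  (suc k) = coeff p k

_≈ₚ_ : Poly → Poly → Set
p ≈ₚ q = ∀ k → coeff p k ≡ coeff q k

const : ℤ → Poly
const c = c ∷ []

isZeroℤ : ℤ → Bool
isZeroℤ (+ zero) = true
isZeroℤ _        = false

isZeroPoly : Poly → Bool
isZeroPoly []      = true
isZeroPoly (a ∷ p) = isZeroℤ a ∧ isZeroPoly p

-- degree (index of the last nonzero coefficient; the zero polynomial gets 0)
deg : Poly → ℕ
deg []      = 0
deg (a ∷ p) = if isZeroPoly p then 0 else suc (deg p)

lead : Poly → ℤ
lead p = coeff p (deg p)

infixl 6 _+ₚ_
infixl 7 _*ₚ_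

_+ₚ_ : Poly → Poly → Poly
[]      +ₚ q       = q
(a ∷ p) +ₚ []      = a ∷ p
(a ∷ p) +ₚ (b ∷ q) = (a ℤ.+ b) ∷ (p +ₚ q)

_*ₚ_ : Poly → Poly → Poly
[]      *ₚ q = []
(a ∷ p) *ₚ q = map (a ℤ.*_) q +ₚ (+ 0 ∷ (p *ₚ q))

sgn : ℕ → ℤ
sgn zero          = + 1
sgn (suc zero)    = - (+ 1)
sgn (suc (suc k)) = sgn k

sumFin : (n : ℕ) → (Fin n → ℤ) → ℤ
sumFin zero    h = + 0
sumFin (suc n) h = h Fin.zero ℤ.+ sumFin n (λ i → h (Fin.suc i))

det : (n : ℕ) → (Fin n → Fin n → ℤ) → ℤ
det zero    M = + 1
det (suc n) M =
  sumFin (suc n) (λ j →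
    sgn (toℕ j) ℤ.* M Fin.zero j ℤ.*
      det n (λ r c → M (Fin.suc r) (punchIn j c)))

-- Sylvester matrix of f (degree m) and g (degree n): an (m+n)×(m+n)
-- matrix whose first n rows are the shifted coefficient vectors of f and
-- whose last m rows are the shifted coefficient vectors of g.  Columns
-- are indexed by ascending powers (this reverses the usual column order,
-- which only changes the sign of the determinant).

shiftRow : Poly → ℕ → ℕ → ℤ
shiftRow h s k = if s ≤ᵇ k then coeff h (k ∸ s) else + 0

sylvester : (f g : Poly) → Fin (deg f ℕ.+ deg g) → Fin (deg f ℕ.+ deg g) → ℤ
sylvester f g i k =
  if toℕ i <ᵇ deg g
    then shiftRow f (toℕ i) (toℕ k)
    else shiftRow g (toℕ i ∸ deg g) (toℕ k)

Res : Poly → Poly → ℤ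
Res f g = det (deg f ℕ.+ deg g) (sylvester f g)

R : Poly → Poly → ℕ
R f g = ∣ Res f g ∣

IsMinComb : Poly → Poly → ℕ → Set
IsMinComb f g r =
  (0 ℕ.< r)
  × (∃₂ λ (p q : Poly) → (p *ₚ f +ₚ q *ₚ g) ≈ₚ const (+ r))
  × (∀ (p q : Poly) (s : ℕ) → 0 ℕ.< s →
       (p *ₚ f +ₚ q *ₚ g) ≈ₚ const (+ s) → r ℕ.≤ s)

{-# OPTIONS --safe #-}
module Submission where

open import Defs
open import Data.Nat using (ℕ; _<_; _*_; _^_; _⊔_; _⊓_)
open import Data.Nat.Divisibility using (_∣_)
open import Data.Nat.GCD using (gcd)
open import Data.Integer using (ℤ; +_; ∣_∣)
open import Data.Product using (_×_)
open import Relation.Binary.PropositionalEquality using (_≡_; _≢_)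

open import Data.Bool using (true; false; if_then_else_)
open import Data.Fin using (Fin; toℕ; punchIn)
import Data.Fin as Fin
import Data.Integer as ℤ
import Data.Integer.Properties as ℤₚ
open import Algebra.Properties.AbelianGroup ℤₚ.+-0-abelianGroup
  using (identityʳ-unique; inverseʳ-unique)
open import Data.Integer.Tactic.RingSolver using (solve-∀)
open import Data.List using ([]; _∷_; map)
open import Data.Nat using (zero; suc; _≤_; z<s; s<s; z≤n; s≤s)
import Data.Nat as ℕ
open import Data.Nat.Coprimality as Coprimality
  using (Coprime; coprime-divisor; coprime-factors; coprime-/gcd)
open import Data.Nat.Divisibility using (divides; ∣-trans; ∣1⇒≡1; *-monoʳ-∣; m∣m*n)
open import Data.Nat.DivMod using (_/_; m/n*n≡m)
open import Data.Nat.GCD using (gcd[m,n]∣m; gcd[m,n]∣n; gcd[m,n]≢0)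
import Data.Nat.Properties as ℕₚ
import Data.Nat.Tactic.RingSolver as ℕ-Solver
open import Data.Product using (_,_; proj₁; proj₂; ∃-syntax)
open import Data.Sum using (_⊎_; inj₁; inj₂; [_,_]′)
open import Function using (_∘_)
open import Relation.Binary using (tri<; tri≈; tri>)
open import Relation.Binary.PropositionalEquality
  using (refl; sym; trans; cong; cong₂; cong-app; subst; module ≡-Reasoning)
open import Relation.Nullary using (contradiction)

-- Write m = deg f, n = deg g, e = deg q and j = deg (p f) = deg (q g) = n + e.
-- Modulo multiples of f we have q g ≡ r, so the formal resultant of f (degree m)
-- with q g (degree j) equals L(f)^j r^m up to sign; by multiplicativity of the
-- resultant it is also a multiple of Res(f, g). As determinants: the rows
-- x^k q g (k < m), x^i f (i < n), x^i f g (i < e) are on the one hand integer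
-- combinations of x^i f (i < n), x^k g (k < m + e), whose determinant is
-- L(g)^e Res(f, g), and on the other hand the image of r x^k (k < m), x^i f (i < j),
-- of determinant r^m L(f)^j, under a block triangular matrix of determinant L(g)^e.
-- Cancelling L(g)^e gives Res(f, g) | L(f)^j r^m, and symmetrically
-- Res(f, g) | L(g)^j r^n; both claims follow.

-- The rows x^k q g (k < m) and x^i f (i < n) are too few: polynomials of degree below m + j have m
-- + n + e coefficients. Filling up with x^i f for n <= i < j would spoil the first reading, since
-- these need not be integer combinations of shifts of g and the first n shifts of f. The multiples
-- x^i f g lie in both spans, at the price of a factor L(g) each; the e extra shifts of g bring in
-- the same L(g)^e, which is why it cancels.
--
-- Both readings are products of square integer matrices. Only divisibility is asked, so the
-- cofactor merely has to be an integer: it is a determinant (Res(f, q) up to sign) that is never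
-- evaluated, and the sign between Res(f, g) and Res(g, f) can be absorbed in the same way.
--
-- In the two resulting divisibilities r^m and r^n are raised to r^max(m, n); as (L(f)/d)^j and
-- (L(g)/d)^j are coprime, d^j r^max(m, n) is left. For monic f and g the powers of the leading
-- coefficients are 1, and the smaller exponent can be kept.

opaque
  ∑ : ℕ → (ℕ → ℤ) → ℤ
  ∑ zero    h = + 0
  ∑ (suc n) h = h 0 ℤ.+ ∑ n (h ∘ suc)

  ∑-nil : ∀ h → ∑ 0 h ≡ + 0
  ∑-nil h = refl

  ∑-suc : ∀ n h → ∑ (suc n) h ≡ h 0 ℤ.+ ∑ n (h ∘ suc)
  ∑-suc n h = refl

  ∑-cong : ∀ n {g h : ℕ → ℤ} → (∀ i → i < n → g i ≡ h i) → ∑ n g ≡ ∑ n h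
  ∑-cong zero    eq = refl
  ∑-cong (suc n) eq = cong₂ ℤ._+_ (eq 0 z<s) (∑-cong n (λ i i<n → eq (suc i) (s<s i<n)))

  ∑-zero : ∀ n {h : ℕ → ℤ} → (∀ i → i < n → h i ≡ + 0) → ∑ n h ≡ + 0
  ∑-zero zero    eq = refl
  ∑-zero (suc n) eq = cong₂ ℤ._+_ (eq 0 z<s) (∑-zero n (λ i i<n → eq (suc i) (s<s i<n)))

  ∑-+ : ∀ n (g h : ℕ → ℤ) → ∑ n (λ i → g i ℤ.+ h i) ≡ ∑ n g ℤ.+ ∑ n h
  ∑-+ zero    g h = refl
  ∑-+ (suc n) g h = trans (cong (λ s → g 0 ℤ.+ h 0 ℤ.+ s) (∑-+ n (g ∘ suc) (h ∘ suc)))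
                          (interchange (g 0) (h 0) _ _)
    where
    interchange : ∀ a b c d → a ℤ.+ b ℤ.+ (c ℤ.+ d) ≡ a ℤ.+ c ℤ.+ (b ℤ.+ d)
    interchange = solve-∀

  ∑-*ˡ : ∀ n c (h : ℕ → ℤ) → ∑ n (λ i → c ℤ.* h i) ≡ c ℤ.* ∑ n h
  ∑-*ˡ zero    c h = sym (ℤₚ.*-zeroʳ c)
  ∑-*ˡ (suc n) c h = trans (cong (ℤ._+_ (c ℤ.* h 0)) (∑-*ˡ n c (h ∘ suc)))
                           (sym (ℤₚ.*-distribˡ-+ c (h 0) _))

  ∑-swap : ∀ m n (h : ℕ → ℕ → ℤ) → ∑ m (λ i → ∑ n (h i)) ≡ ∑ n (λ j → ∑ m (λ i → h i j))
  ∑-swap zero    n h = sym (∑-zero n (λ _ _ → refl))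
  ∑-swap (suc m) n h = trans (cong (ℤ._+_ (∑ n (h 0))) (∑-swap m n (h ∘ suc)))
                             (sym (∑-+ n (h 0) _))

  ∑-++ : ∀ m n (h : ℕ → ℤ) → ∑ (m ℕ.+ n) h ≡ ∑ m h ℤ.+ ∑ n (λ i → h (m ℕ.+ i))
  ∑-++ zero    n h = sym (ℤₚ.+-identityˡ _)
  ∑-++ (suc m) n h = trans (cong (ℤ._+_ (h 0)) (∑-++ m n (h ∘ suc))) (sym (ℤₚ.+-assoc (h 0) _ _))

  ∑-last : ∀ n (h : ℕ → ℤ) → ∑ (suc n) h ≡ ∑ n h ℤ.+ h n
  ∑-last zero    h = ℤₚ.+-comm (h 0) (+ 0)
  ∑-last (suc n) h = trans (cong (ℤ._+_ (h 0)) (∑-last n (h ∘ suc))) (sym (ℤₚ.+-assoc (h 0) _ _))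

∑-truncate : ∀ m n (h : ℕ → ℤ) → (∀ i → m ≤ i → h i ≡ + 0) → ∑ (m ℕ.+ n) h ≡ ∑ m h
∑-truncate m n h h≡0 = trans (∑-++ m n h)
  (trans (cong (ℤ._+_ (∑ m h)) (∑-zero n (λ i _ → h≡0 (m ℕ.+ i) (ℕₚ.m≤m+n m i)))) (ℤₚ.+-identityʳ _))

∑-support : ∀ m n (h : ℕ → ℤ) → (∀ i → m ≤ i → h i ≡ + 0) → (∀ i → n ≤ i → h i ≡ + 0) → ∑ m h ≡ ∑ n h
∑-support m n h zm zn = trans (sym (∑-truncate m n h zm))
  (trans (cong (λ k → ∑ k h) (ℕₚ.+-comm m n)) (∑-truncate n m h zn))

-- skip j enumerates ℕ without j.
skip : ℕ → ℕ → ℕ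
skip zero    c       = suc c
skip (suc j) zero    = zero
skip (suc j) (suc c) = suc (skip j c)

skip-< : ∀ j {c n} → c < n → skip j c < suc n
skip-< zero    c<n       = s<s c<n
skip-< (suc j) {zero}  c<n = z<s
skip-< (suc j) {suc c} (s<s c<n) = s<s (skip-< j c<n)

skip-last : ∀ {j n} → j ≤ n → skip j n ≡ suc n
skip-last z≤n       = refl
skip-last (s≤s j≤n) = cong suc (skip-last j≤n)

∑-skip : ∀ {n l} (h : ℕ → ℤ) → l < suc n → ∑ (suc n) h ≡ h l ℤ.+ ∑ n (h ∘ skip l)
∑-skip {n} {zero} h l<n = ∑-suc n h
∑-skip {suc n} {suc l} h (s<s l<n) = begin
  ∑ (suc (suc n)) h
    ≡⟨ ∑-suc (suc n) h ⟩
  h 0 ℤ.+ ∑ (suc n) (h ∘ suc)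
    ≡⟨ cong (ℤ._+_ (h 0)) (∑-skip (h ∘ suc) l<n) ⟩
  h 0 ℤ.+ (h (suc l) ℤ.+ ∑ n (h ∘ suc ∘ skip l))
    ≡⟨ swap (h 0) (h (suc l)) _ ⟩
  h (suc l) ℤ.+ (h 0 ℤ.+ ∑ n (h ∘ suc ∘ skip l))
    ≡⟨ cong (ℤ._+_ (h (suc l))) (∑-suc n (h ∘ skip (suc l))) ⟨
  h (suc l) ℤ.+ ∑ (suc n) (h ∘ skip (suc l)) ∎
  where
  open ≡-Reasoning
  swap : ∀ a b c → a ℤ.+ (b ℤ.+ c) ≡ b ℤ.+ (a ℤ.+ c)
  swap = solve-∀

sgn-suc : ∀ k → sgn (suc k) ≡ ℤ.- sgn k
sgn-suc zero          = refl
sgn-suc (suc zero)    = refl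
sgn-suc (suc (suc k)) = sgn-suc k

sgn*sgn : ∀ k → sgn k ℤ.* sgn k ≡ + 1
sgn*sgn zero          = refl
sgn*sgn (suc zero)    = refl
sgn*sgn (suc (suc k)) = sgn*sgn k

-- Determinants

-- Matrices are indexed by ℕ; D n reads off the leading n × n block.
Matrix : Set
Matrix = ℕ → ℕ → ℤ

minor : ℕ → Matrix → Matrix
minor j M r c = M (suc r) (skip j c)

opaque
  D : ℕ → Matrix → ℤ
  D zero    M = + 1
  D (suc n) M = ∑ (suc n) (λ j → sgn j ℤ.* M 0 j ℤ.* D n (minor j M))

  D-nil : ∀ M → D 0 M ≡ + 1
  D-nil M = refl

  D-row : ∀ n M → D (suc n) M ≡ ∑ (suc n) (λ j → sgn j ℤ.* M 0 j ℤ.* D n (minor j M))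
  D-row n M = refl

D-cong : ∀ n {M M′ : Matrix} → (∀ i j → i < n → j < n → M i j ≡ M′ i j) → D n M ≡ D n M′
D-cong zero    {M} {M′} eq = trans (D-nil M) (sym (D-nil M′))
D-cong (suc n) {M} {M′} eq = trans (D-row n M) (trans (∑-cong (suc n) λ j j<n →
  cong₂ ℤ._*_ (cong (ℤ._*_ (sgn j)) (eq 0 j z<s j<n))
    (D-cong n λ r c r<n c<n → eq (suc r) (skip j c) (s<s r<n) (skip-< j c<n))) (sym (D-row n M′)))

toℕ-punchIn : ∀ {n} (j : Fin (suc n)) c → toℕ (punchIn j c) ≡ skip (toℕ j) (toℕ c)
toℕ-punchIn Fin.zero    c           = refl
toℕ-punchIn (Fin.suc j) Fin.zero    = refl
toℕ-punchIn (Fin.suc j) (Fin.suc c) = cong suc (toℕ-punchIn j c)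

sumFin≡∑ : ∀ n {g : Fin n → ℤ} {h : ℕ → ℤ} → (∀ i → g i ≡ h (toℕ i)) → sumFin n g ≡ ∑ n h
sumFin≡∑ zero    {h = h} eq = sym (∑-nil h)
sumFin≡∑ (suc n) {h = h} eq =
  trans (cong₂ ℤ._+_ (eq Fin.zero) (sumFin≡∑ n (eq ∘ Fin.suc))) (sym (∑-suc n h))

det≡D : ∀ n {A : Fin n → Fin n → ℤ} {M : Matrix} →
        (∀ i j → A i j ≡ M (toℕ i) (toℕ j)) → det n A ≡ D n M
det≡D zero    {A} {M} eq = sym (D-nil M)
det≡D (suc n) {A} {M} eq = trans (sumFin≡∑ (suc n) {h = h} λ j →
  cong₂ ℤ._*_ (cong (ℤ._*_ (sgn (toℕ j))) (eq Fin.zero j))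
    (det≡D n {M = minor (toℕ j) M} λ r c →
      trans (eq (Fin.suc r) (punchIn j c)) (cong (M (suc (toℕ r))) (toℕ-punchIn j c))))
  (sym (D-row n M))
  where
  h : ℕ → ℤ
  h j = sgn j ℤ.* M 0 j ℤ.* D n (minor j M)

-- One statement for additivity and scaling in row `i`. In row 0 the entries split and the minors
-- agree; in a later row the entries agree and the minors split by induction.
D-linear : ∀ n {i} c {M A B : Matrix} → i < n →
  (∀ k → k ≢ i → ∀ j → M k j ≡ A k j) → (∀ k → k ≢ i → ∀ j → M k j ≡ B k j) →
  (∀ j → M i j ≡ A i j ℤ.+ c ℤ.* B i j) → D n M ≡ D n A ℤ.+ c ℤ.* D n B
D-linear (suc n) {i} c {M} {A} {B} i<n M≈A M≈B row = begin
  D (suc n) M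
    ≡⟨ D-row n M ⟩
  ∑ (suc n) (λ j → sgn j ℤ.* M 0 j ℤ.* D n (minor j M))
    ≡⟨ ∑-cong (suc n) (term i i<n M≈A M≈B row) ⟩
  ∑ (suc n) (λ j → rowTerm A j ℤ.+ c ℤ.* rowTerm B j)
    ≡⟨ ∑-+ (suc n) (rowTerm A) (λ j → c ℤ.* rowTerm B j) ⟩
  ∑ (suc n) (rowTerm A) ℤ.+ ∑ (suc n) (λ j → c ℤ.* rowTerm B j)
    ≡⟨ cong₂ ℤ._+_ (sym (D-row n A))
         (trans (∑-*ˡ (suc n) c (rowTerm B)) (cong (ℤ._*_ c) (sym (D-row n B)))) ⟩
  D (suc n) A ℤ.+ c ℤ.* D (suc n) B ∎
  where
  open ≡-Reasoning
  rowTerm : Matrix → ℕ → ℤ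
  rowTerm N j = sgn j ℤ.* N 0 j ℤ.* D n (minor j N)
  distrib-entry : ∀ c s a b d → s ℤ.* (a ℤ.+ c ℤ.* b) ℤ.* d ≡ s ℤ.* a ℤ.* d ℤ.+ c ℤ.* (s ℤ.* b ℤ.* d)
  distrib-entry = solve-∀
  distrib-minor : ∀ c s a x y → s ℤ.* a ℤ.* (x ℤ.+ c ℤ.* y) ≡ s ℤ.* a ℤ.* x ℤ.+ c ℤ.* (s ℤ.* a ℤ.* y)
  distrib-minor = solve-∀
  term : ∀ i → i < suc n →
    (∀ k → k ≢ i → ∀ j → M k j ≡ A k j) → (∀ k → k ≢ i → ∀ j → M k j ≡ B k j) →
    (∀ j → M i j ≡ A i j ℤ.+ c ℤ.* B i j) → ∀ j → j < suc n →
    sgn j ℤ.* M 0 j ℤ.* D n (minor j M) ≡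
    sgn j ℤ.* A 0 j ℤ.* D n (minor j A) ℤ.+ c ℤ.* (sgn j ℤ.* B 0 j ℤ.* D n (minor j B))
  term zero i<n M≈A M≈B row j _
    rewrite row j
          | sym (D-cong n {minor j M} {minor j A} λ r d _ _ → M≈A (suc r) (λ ()) (skip j d))
          | sym (D-cong n {minor j M} {minor j B} λ r d _ _ → M≈B (suc r) (λ ()) (skip j d))
    = distrib-entry c (sgn j) (A 0 j) (B 0 j) (D n (minor j M))
  term (suc i) (s<s i<n) M≈A M≈B row j _
    rewrite sym (M≈A 0 (λ ()) j) | sym (M≈B 0 (λ ()) j)
          | D-linear n c {minor j M} {minor j A} {minor j B} i<n
              (λ k k≢i d → M≈A (suc k) (k≢i ∘ ℕₚ.suc-injective) (skip j d))
              (λ k k≢i d → M≈B (suc k) (k≢i ∘ ℕₚ.suc-injective) (skip j d))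
              (λ d → row (skip j d))
    = distrib-minor c (sgn j) (M 0 j) (D n (minor j A)) (D n (minor j B))

columnMinor : ℕ → Matrix → Matrix
columnMinor i M r c = M (skip i r) (suc c)

-- Induction on the size: after the corner term, each minor of the row expansion is expanded along
-- its first column. The double minor `d i j` does not depend on the order of the deletions, so the
-- double sum can be regrouped by rows. Repeated rows become tractable this way, since most minors
-- of a column expansion keep both copies.
D-column : ∀ n (M : Matrix) →
  D (suc n) M ≡ ∑ (suc n) (λ i → sgn i ℤ.* M i 0 ℤ.* D n (columnMinor i M))
D-column zero    M = trans (D-row 0 M) (∑-cong 1 λ { zero _ →
  cong (ℤ._*_ (+ 1 ℤ.* M 0 0)) (trans (D-nil _) (sym (D-nil _))) ; (suc _) (s<s ()) })
D-column (suc n) M = begin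
  D (suc (suc n)) M
    ≡⟨ trans (D-row (suc n) M) (∑-suc (suc n) _) ⟩
  + 1 ℤ.* M 0 0 ℤ.* D (suc n) (minor 0 M) ℤ.+
    ∑ (suc n) (λ j → sgn (suc j) ℤ.* M 0 (suc j) ℤ.* D (suc n) (minor (suc j) M))
    ≡⟨ cong (ℤ._+_ (+ 1 ℤ.* M 0 0 ℤ.* D (suc n) (minor 0 M))) tail ⟩
  + 1 ℤ.* M 0 0 ℤ.* D (suc n) (columnMinor 0 M) ℤ.+
    ∑ (suc n) (λ i → sgn (suc i) ℤ.* M (suc i) 0 ℤ.* D (suc n) (columnMinor (suc i) M))
    ≡⟨ ∑-suc (suc n) _ ⟨
  ∑ (suc (suc n)) (λ i → sgn i ℤ.* M i 0 ℤ.* D (suc n) (columnMinor i M)) ∎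
  where
  open ≡-Reasoning
  d : ℕ → ℕ → ℤ
  d i j = D n (λ r c → M (suc (skip i r)) (suc (skip j c)))
  signs : ∀ s t a b d → ℤ.- s ℤ.* a ℤ.* (t ℤ.* b ℤ.* d) ≡ ℤ.- t ℤ.* b ℤ.* (s ℤ.* a ℤ.* d)
  signs = solve-∀
  exchange : ∀ i j →
    sgn (suc j) ℤ.* M 0 (suc j) ℤ.* (sgn i ℤ.* M (suc i) 0 ℤ.* d i j) ≡
    sgn (suc i) ℤ.* M (suc i) 0 ℤ.* (sgn j ℤ.* M 0 (suc j) ℤ.* d i j)
  exchange i j rewrite sgn-suc i | sgn-suc j =
    signs (sgn j) (sgn i) (M 0 (suc j)) (M (suc i) 0) (d i j)
  tail : ∑ (suc n) (λ j → sgn (suc j) ℤ.* M 0 (suc j) ℤ.* D (suc n) (minor (suc j) M)) ≡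
         ∑ (suc n) (λ i → sgn (suc i) ℤ.* M (suc i) 0 ℤ.* D (suc n) (columnMinor (suc i) M))
  tail = begin
    ∑ (suc n) (λ j → sgn (suc j) ℤ.* M 0 (suc j) ℤ.* D (suc n) (minor (suc j) M))
      ≡⟨ ∑-cong (suc n) (λ j _ →
           trans (cong (ℤ._*_ (sgn (suc j) ℤ.* M 0 (suc j))) (D-column n (minor (suc j) M)))
                 (sym (∑-*ˡ (suc n) (sgn (suc j) ℤ.* M 0 (suc j)) _))) ⟩
    ∑ (suc n) (λ j → ∑ (suc n) (λ i →
      sgn (suc j) ℤ.* M 0 (suc j) ℤ.* (sgn i ℤ.* M (suc i) 0 ℤ.* d i j)))
      ≡⟨ ∑-swap (suc n) (suc n) _ ⟩
    ∑ (suc n) (λ i → ∑ (suc n) (λ j →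
      sgn (suc j) ℤ.* M 0 (suc j) ℤ.* (sgn i ℤ.* M (suc i) 0 ℤ.* d i j)))
      ≡⟨ ∑-cong (suc n) (λ i _ → begin
           ∑ (suc n) (λ j → sgn (suc j) ℤ.* M 0 (suc j) ℤ.* (sgn i ℤ.* M (suc i) 0 ℤ.* d i j))
             ≡⟨ ∑-cong (suc n) (λ j _ → exchange i j) ⟩
           ∑ (suc n) (λ j → sgn (suc i) ℤ.* M (suc i) 0 ℤ.* (sgn j ℤ.* M 0 (suc j) ℤ.* d i j))
             ≡⟨ ∑-*ˡ (suc n) (sgn (suc i) ℤ.* M (suc i) 0) _ ⟩
           sgn (suc i) ℤ.* M (suc i) 0 ℤ.* ∑ (suc n) (λ j → sgn j ℤ.* M 0 (suc j) ℤ.* d i j)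
             ≡⟨ cong (ℤ._*_ (sgn (suc i) ℤ.* M (suc i) 0)) (D-row n (columnMinor (suc i) M)) ⟨
           sgn (suc i) ℤ.* M (suc i) 0 ℤ.* D (suc n) (columnMinor (suc i) M) ∎) ⟩
    ∑ (suc n) (λ i → sgn (suc i) ℤ.* M (suc i) 0 ℤ.* D (suc n) (columnMinor (suc i) M)) ∎

-- In the expansion along the first column the minors without row 0 and without row 1 coincide and
-- carry opposite signs; every other minor still begins with two equal rows.
D-rows01 : ∀ n (M : Matrix) → (∀ j → M 0 j ≡ M 1 j) → D (suc (suc n)) M ≡ + 0
D-rows01 n M eq = begin
  D (suc (suc n)) M
    ≡⟨ trans (D-column (suc n) M)
         (trans (∑-suc (suc n) _) (cong (ℤ._+_ (+ 1 ℤ.* M 0 0 ℤ.* d 0)) (∑-suc n _))) ⟩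
  + 1 ℤ.* M 0 0 ℤ.* d 0 ℤ.+ (ℤ.- (+ 1) ℤ.* M 1 0 ℤ.* d 1 ℤ.+ rest n)
    ≡⟨ cong₂ (λ a b → a ℤ.+ (ℤ.- (+ 1) ℤ.* M 1 0 ℤ.* d 1 ℤ.+ b))
         (cong₂ (λ a b → + 1 ℤ.* a ℤ.* b) (eq 0) d0≡d1) (rest≡0 n M eq) ⟩
  + 1 ℤ.* M 1 0 ℤ.* d 1 ℤ.+ (ℤ.- (+ 1) ℤ.* M 1 0 ℤ.* d 1 ℤ.+ + 0)
    ≡⟨ cancel (M 1 0) (d 1) ⟩
  + 0 ∎
  where
  open ≡-Reasoning
  d : ℕ → ℤ
  d i = D (suc n) (columnMinor i M)
  rest : ℕ → ℤ
  rest k = ∑ k (λ i → sgn (suc (suc i)) ℤ.* M (suc (suc i)) 0 ℤ.* d (suc (suc i)))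
  cancel : ∀ a d → + 1 ℤ.* a ℤ.* d ℤ.+ (ℤ.- (+ 1) ℤ.* a ℤ.* d ℤ.+ + 0) ≡ + 0
  cancel = solve-∀
  d0≡d1 : d 0 ≡ d 1
  d0≡d1 = D-cong (suc n) {columnMinor 0 M} {columnMinor 1 M} λ
    { zero c _ _ → sym (eq (suc c)) ; (suc r) c _ _ → refl }
  rest≡0 : ∀ n (M : Matrix) → (∀ j → M 0 j ≡ M 1 j) →
    ∑ n (λ i → sgn (suc (suc i)) ℤ.* M (suc (suc i)) 0 ℤ.* D (suc n) (columnMinor (suc (suc i)) M)) ≡ + 0
  rest≡0 zero    M eq = ∑-nil _
  rest≡0 (suc n) M eq = ∑-zero (suc n) λ i _ →
    trans (cong (ℤ._*_ (sgn (suc (suc i)) ℤ.* M (suc (suc i)) 0))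
                (D-rows01 n (columnMinor (suc (suc i)) M) (λ j → eq (suc j))))
          (ℤₚ.*-zeroʳ (sgn (suc (suc i)) ℤ.* M (suc (suc i)) 0))

D-row-zero : ∀ n {i} {M : Matrix} → i < n → (∀ j → M i j ≡ + 0) → D n M ≡ + 0
D-row-zero n {i} {M} i<n row≡0 = identityʳ-unique (D n M) (D n M) (begin
  D n M ℤ.+ D n M         ≡⟨ cong (ℤ._+_ (D n M)) (ℤₚ.*-identityˡ (D n M)) ⟨
  D n M ℤ.+ + 1 ℤ.* D n M ≡⟨ D-linear n (+ 1) i<n (λ _ _ _ → refl) (λ _ _ _ → refl) double ⟨
  D n M                   ∎)
  where
  open ≡-Reasoning
  double : ∀ j → M i j ≡ M i j ℤ.+ + 1 ℤ.* M i j
  double j rewrite row≡0 j = refl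

-- Permuting, repeating and combining rows

_∷ᴿ_ : (ℕ → ℤ) → Matrix → Matrix
(v ∷ᴿ M) zero    = v
(v ∷ᴿ M) (suc i) = M i
infixr 5 _∷ᴿ_

-- Polarisation: with `w = u + v` in both places the determinant is 0, and expanding it leaves the
-- two mixed terms.
D-swap01 : ∀ n (u v : ℕ → ℤ) (R : Matrix) →
  D (suc (suc n)) (u ∷ᴿ v ∷ᴿ R) ≡ ℤ.- D (suc (suc n)) (v ∷ᴿ u ∷ᴿ R)
D-swap01 n u v R = inverseʳ-unique (N v u) (N u v) (begin
  N v u ℤ.+ N u v
    ≡⟨ pad (N v u) (N u v) (alt u) (alt v) ⟩
  (N u u ℤ.+ + 1 ℤ.* N u v) ℤ.+ + 1 ℤ.* (N v u ℤ.+ + 1 ℤ.* N v v)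
    ≡⟨ cong₂ (λ a b → a ℤ.+ + 1 ℤ.* b) (split u) (split v) ⟨
  N u w ℤ.+ + 1 ℤ.* N v w
    ≡⟨ D-linear (suc (suc n)) {0} (+ 1) z<s away away (λ _ → refl) ⟨
  N w w
    ≡⟨ alt w ⟩
  + 0 ∎)
  where
  open ≡-Reasoning
  N : (ℕ → ℤ) → (ℕ → ℤ) → ℤ
  N x y = D (suc (suc n)) (x ∷ᴿ y ∷ᴿ R)
  w : ℕ → ℤ
  w j = u j ℤ.+ + 1 ℤ.* v j
  away : ∀ {x x′ R} k → k ≢ 0 → ∀ j → (x ∷ᴿ R) k j ≡ (x′ ∷ᴿ R) k j
  away zero    k≢0 j = contradiction refl k≢0
  away (suc k) k≢0 j = refl
  away₁ : ∀ {x y y′ R} k → k ≢ 1 → ∀ j → (x ∷ᴿ y ∷ᴿ R) k j ≡ (x ∷ᴿ y′ ∷ᴿ R) k j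
  away₁ zero          k≢1 j = refl
  away₁ (suc zero)    k≢1 j = contradiction refl k≢1
  away₁ (suc (suc k)) k≢1 j = refl
  alt : ∀ x → N x x ≡ + 0
  alt x = D-rows01 n (x ∷ᴿ x ∷ᴿ R) (λ _ → refl)
  split : ∀ x → N x w ≡ N x u ℤ.+ + 1 ℤ.* N x v
  split x = D-linear (suc (suc n)) {1} (+ 1) (s<s z<s) away₁ away₁ (λ _ → refl)
  pad : ∀ b c {a d} → a ≡ + 0 → d ≡ + 0 → b ℤ.+ c ≡ (a ℤ.+ + 1 ℤ.* c) ℤ.+ + 1 ℤ.* (b ℤ.+ + 1 ℤ.* d)
  pad b c refl refl = ring b c
    where
    ring : ∀ b c → b ℤ.+ c ≡ (+ 0 ℤ.+ + 1 ℤ.* c) ℤ.+ + 1 ℤ.* (b ℤ.+ + 1 ℤ.* + 0)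
    ring = solve-∀

-- ρ k l brings row k + l up to position k.
ρ : ℕ → ℕ → ℕ → ℕ
ρ zero    l zero    = l
ρ zero    l (suc i) = skip l i
ρ (suc k) l zero    = zero
ρ (suc k) l (suc i) = suc (ρ k l i)

ρ-below : ∀ {k i} l → i < k → ρ k l i ≡ i
ρ-below {suc k} {zero}  l i<k       = refl
ρ-below {suc k} {suc i} l (s<s i<k) = cong suc (ρ-below l i<k)

ρ-at : ∀ k l → ρ k l k ≡ k ℕ.+ l
ρ-at zero    l = refl
ρ-at (suc k) l = cong suc (ρ-at k l)

ρ-above : ∀ k l i → ρ k l (suc k ℕ.+ i) ≡ k ℕ.+ skip l i
ρ-above zero    l i = refl
ρ-above (suc k) l i = cong suc (ρ-above k l i)

-- The inductive step for claims that leave row 0 in place: `D-rotate` takes `c = sgn l`,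
-- `D-alternating` takes `c = 0`.
D-scale : ∀ n c {M N : Matrix} → (∀ j → M 0 j ≡ N 0 j) →
  (∀ j → j < suc n → D n (minor j M) ≡ c ℤ.* D n (minor j N)) →
  D (suc n) M ≡ c ℤ.* D (suc n) N
D-scale n c {M} {N} row minors = begin
  D (suc n) M
    ≡⟨ D-row n M ⟩
  ∑ (suc n) (λ j → sgn j ℤ.* M 0 j ℤ.* D n (minor j M))
    ≡⟨ ∑-cong (suc n) (λ j j<n →
         trans (cong₂ (λ a d → sgn j ℤ.* a ℤ.* d) (row j) (minors j j<n))
               (pull c (sgn j) (N 0 j) _)) ⟩
  ∑ (suc n) (λ j → c ℤ.* (sgn j ℤ.* N 0 j ℤ.* D n (minor j N)))
    ≡⟨ ∑-*ˡ (suc n) c _ ⟩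
  c ℤ.* ∑ (suc n) (λ j → sgn j ℤ.* N 0 j ℤ.* D n (minor j N))
    ≡⟨ cong (ℤ._*_ c) (D-row n N) ⟨
  c ℤ.* D (suc n) N ∎
  where
  open ≡-Reasoning
  pull : ∀ c s a d → s ℤ.* a ℤ.* (c ℤ.* d) ≡ c ℤ.* (s ℤ.* a ℤ.* d)
  pull = solve-∀

-- One swap of the top two rows turns `ρ 0 (suc l)` into `ρ 1 l`, which fixes row 0, so the
-- remaining `l` swaps take place inside the minors.
D-rotate : ∀ n k l (M : Matrix) → k ℕ.+ l < n → D n (M ∘ ρ k l) ≡ sgn l ℤ.* D n M
D-rotate (suc n) (suc k) l M (s<s k+l<n) =
  D-scale n (sgn l) {M ∘ ρ (suc k) l} {M} (λ _ → refl) (λ j _ → D-rotate n k l (minor j M) k+l<n)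
D-rotate (suc n) zero zero M _ =
  trans (D-cong (suc n) {M ∘ ρ 0 0} {M} λ { zero _ _ _ → refl ; (suc r) _ _ _ → refl })
        (sym (ℤₚ.*-identityˡ (D (suc n) M)))
D-rotate (suc zero) zero (suc l) M (s<s ())
D-rotate (suc (suc n)) zero (suc l) M l<n = begin
  D (suc (suc n)) (M ∘ ρ 0 (suc l))
    ≡⟨ D-cong (suc (suc n)) {M ∘ ρ 0 (suc l)} {M (suc l) ∷ᴿ M 0 ∷ᴿ others}
         (λ { zero _ _ _ → refl ; (suc zero) _ _ _ → refl ; (suc (suc i)) _ _ _ → refl }) ⟩
  D (suc (suc n)) (M (suc l) ∷ᴿ M 0 ∷ᴿ others)
    ≡⟨ D-swap01 n (M (suc l)) (M 0) others ⟩
  ℤ.- D (suc (suc n)) (M 0 ∷ᴿ M (suc l) ∷ᴿ others)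
    ≡⟨ cong ℤ.-_ (D-cong (suc (suc n)) {M 0 ∷ᴿ M (suc l) ∷ᴿ others} {M ∘ ρ 1 l}
         (λ { zero _ _ _ → refl ; (suc zero) _ _ _ → refl ; (suc (suc i)) _ _ _ → refl })) ⟩
  ℤ.- D (suc (suc n)) (M ∘ ρ 1 l)
    ≡⟨ cong ℤ.-_ (D-rotate (suc (suc n)) 1 l M l<n) ⟩
  ℤ.- (sgn l ℤ.* D (suc (suc n)) M)
    ≡⟨ ℤₚ.neg-distribˡ-* (sgn l) _ ⟩
  ℤ.- sgn l ℤ.* D (suc (suc n)) M
    ≡⟨ cong (ℤ._* D (suc (suc n)) M) (sgn-suc l) ⟨
  sgn (suc l) ℤ.* D (suc (suc n)) M ∎
  where
  open ≡-Reasoning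
  others : Matrix
  others i = M (suc (skip l i))

-- Rotation brings the second copy next to the first, where `D-rows01` applies; the sign is undone
-- by `sgn k * sgn k = 1`. A first copy below row 0 is handled in the minors.
D-alternating : ∀ n {i k} (M : Matrix) → i < k → k < n → (∀ j → M i j ≡ M k j) → D n M ≡ + 0
D-alternating (suc (suc n)) {zero} {suc k} M _ k<n eq = begin
  D (suc (suc n)) M
    ≡⟨ ℤₚ.*-identityˡ _ ⟨
  + 1 ℤ.* D (suc (suc n)) M
    ≡⟨ cong (ℤ._* D (suc (suc n)) M) (sgn*sgn k) ⟨
  sgn k ℤ.* sgn k ℤ.* D (suc (suc n)) M
    ≡⟨ ℤₚ.*-assoc (sgn k) (sgn k) _ ⟩
  sgn k ℤ.* (sgn k ℤ.* D (suc (suc n)) M)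
    ≡⟨ cong (ℤ._*_ (sgn k)) (D-rotate (suc (suc n)) 1 k M k<n) ⟨
  sgn k ℤ.* D (suc (suc n)) (M ∘ ρ 1 k)
    ≡⟨ cong (ℤ._*_ (sgn k)) (D-rows01 n (M ∘ ρ 1 k) eq) ⟩
  sgn k ℤ.* + 0
    ≡⟨ ℤₚ.*-zeroʳ (sgn k) ⟩
  + 0 ∎
  where open ≡-Reasoning
D-alternating (suc zero) {zero} {suc k} M _ (s<s ()) eq
D-alternating (suc n) {suc i} {suc k} M (s<s i<k) (s<s k<n) eq =
  D-scale n (+ 0) {M} {M} (λ _ → refl) (λ j _ →
    trans (D-alternating n (minor j M) i<k k<n (eq ∘ skip j)) (sym (ℤₚ.*-zeroˡ (D n (minor j M)))))

upd : ℕ → (ℕ → ℤ) → Matrix → Matrix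
upd zero    v M zero    = v
upd zero    v M (suc i) = M (suc i)
upd (suc k) v M zero    = M zero
upd (suc k) v M (suc i) = upd k v (M ∘ suc) i

upd-at : ∀ k v M → upd k v M k ≡ v
upd-at zero    v M = refl
upd-at (suc k) v M = upd-at k v (M ∘ suc)

upd-off : ∀ k v M {i} → i ≢ k → upd k v M i ≡ M i
upd-off zero    v M {zero}  i≢k = contradiction refl i≢k
upd-off zero    v M {suc i} i≢k = refl
upd-off (suc k) v M {zero}  i≢k = refl
upd-off (suc k) v M {suc i} i≢k = upd-off k v (M ∘ suc) (i≢k ∘ cong suc)

upd-upd : ∀ k v w M i → upd k v (upd k w M) i ≡ upd k v M i
upd-upd zero    v w M zero    = refl
upd-upd zero    v w M (suc i) = refl
upd-upd (suc k) v w M zero    = refl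
upd-upd (suc k) v w M (suc i) = upd-upd k v w (M ∘ suc) i

D-linear-upd : ∀ n {k} c (M : Matrix) (u v : ℕ → ℤ) → k < n →
  (∀ j → M k j ≡ u j ℤ.+ c ℤ.* v j) →
  D n M ≡ D n (upd k u M) ℤ.+ c ℤ.* D n (upd k v M)
D-linear-upd n {k} c M u v k<n row = D-linear n c k<n
  (λ i i≢k j → sym (cong-app (upd-off k u M i≢k) j))
  (λ i i≢k j → sym (cong-app (upd-off k v M i≢k) j))
  (λ j → trans (row j) (sym (cong₂ (λ a b → a ℤ.+ c ℤ.* b)
    (cong-app (upd-at k u M) j) (cong-app (upd-at k v M) j))))

-- The rows from `k` on are restored one at a time. Since `t < k`, row `t` is the same throughout,
-- so each correction term has two equal rows.
D-clear : ∀ d k {t} (c : ℕ → ℤ) (M N : Matrix) → t < k →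
  (∀ i → i < k → ∀ j → M i j ≡ N i j) →
  (∀ i j → M (k ℕ.+ i) j ≡ N (k ℕ.+ i) j ℤ.+ c i ℤ.* N t j) →
  D (k ℕ.+ d) M ≡ D (k ℕ.+ d) N
D-clear zero    k c M N t<k above below =
  D-cong (k ℕ.+ 0) λ i j i<n _ → above i (subst (i <_) (ℕₚ.+-identityʳ k) i<n) j
D-clear (suc d) k {t} c M N t<k above below = begin
  D n M
    ≡⟨ D-linear-upd n (c 0) M (N k) (N t) k<n
         (λ j → subst (λ i → M i j ≡ N i j ℤ.+ c 0 ℤ.* N t j) (ℕₚ.+-identityʳ k) (below 0 j)) ⟩
  D n (upd k (N k) M) ℤ.+ c 0 ℤ.* D n (upd k (N t) M)
    ≡⟨ cong (λ x → D n (upd k (N k) M) ℤ.+ c 0 ℤ.* x)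
         (D-alternating n (upd k (N t) M) t<k k<n
           (λ j → trans (cong-app (upd-off k (N t) M (ℕₚ.<⇒≢ t<k)) j)
                  (trans (above t t<k j) (sym (cong-app (upd-at k (N t) M) j))))) ⟩
  D n (upd k (N k) M) ℤ.+ c 0 ℤ.* + 0
    ≡⟨ trans (cong (ℤ._+_ (D n (upd k (N k) M))) (ℤₚ.*-zeroʳ (c 0))) (ℤₚ.+-identityʳ _) ⟩
  D n (upd k (N k) M)
    ≡⟨ subst (λ m → D m (upd k (N k) M) ≡ D m N) (sym (ℕₚ.+-suc k d))
         (D-clear d (suc k) (c ∘ suc) (upd k (N k) M) N (ℕₚ.m<n⇒m<1+n t<k) above′ below′) ⟩
  D n N ∎
  where
  open ≡-Reasoning
  n : ℕ
  n = k ℕ.+ suc d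
  k<n : k < n
  k<n = ℕₚ.m<m+n k z<s
  above′ : ∀ i → i < suc k → ∀ j → upd k (N k) M i j ≡ N i j
  above′ i (s≤s i≤k) j with ℕₚ.m≤n⇒m<n∨m≡n i≤k
  ... | inj₁ i<k  = trans (cong-app (upd-off k (N k) M (ℕₚ.<⇒≢ i<k)) j) (above i i<k j)
  ... | inj₂ refl = cong-app (upd-at k (N k) M) j
  below′ : ∀ i j → upd k (N k) M (suc k ℕ.+ i) j ≡ N (suc k ℕ.+ i) j ℤ.+ c (suc i) ℤ.* N t j
  below′ i j = trans (cong-app (upd-off k (N k) M (ℕₚ.m+1+n≢m k ∘ trans (ℕₚ.+-suc k i))) j)
    (subst (λ x → M x j ≡ N x j ℤ.+ c (suc i) ℤ.* N t j) (ℕₚ.+-suc k i) (below (suc i) j))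

D-row-∑ : ∀ n {k} m (c : ℕ → ℤ) (V M : Matrix) → k < n →
  (∀ j → M k j ≡ ∑ m (λ l → c l ℤ.* V l j)) →
  D n M ≡ ∑ m (λ l → c l ℤ.* D n (upd k (V l) M))
D-row-∑ n zero    c V M k<n row =
  trans (D-row-zero n k<n (λ j → trans (row j) (∑-nil _))) (sym (∑-nil _))
D-row-∑ n {k} (suc m) c V M k<n row = begin
  D n M
    ≡⟨ D-linear-upd n (c 0) M rest (V 0) k<n
         (λ j → trans (row j) (trans (∑-suc m _) (ℤₚ.+-comm (c 0 ℤ.* V 0 j) _))) ⟩
  D n (upd k rest M) ℤ.+ c 0 ℤ.* D n (upd k (V 0) M)
    ≡⟨ cong (ℤ._+ c 0 ℤ.* D n (upd k (V 0) M))
         (trans (D-row-∑ n m (c ∘ suc) (V ∘ suc) (upd k rest M) k<n (λ j → cong-app (upd-at k rest M) j))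
                (∑-cong m (λ l _ → cong (ℤ._*_ (c (suc l)))
                  (D-cong n (λ i j _ _ → cong-app (upd-upd k (V (suc l)) rest M i) j))))) ⟩
  ∑ m (λ l → c (suc l) ℤ.* D n (upd k (V (suc l)) M)) ℤ.+ c 0 ℤ.* D n (upd k (V 0) M)
    ≡⟨ trans (ℤₚ.+-comm _ (c 0 ℤ.* D n (upd k (V 0) M))) (sym (∑-suc m _)) ⟩
  ∑ (suc m) (λ l → c l ℤ.* D n (upd k (V l) M)) ∎
  where
  open ≡-Reasoning
  rest : ℕ → ℤ
  rest j = ∑ m (λ l → c (suc l) ℤ.* V (suc l) j)

infixr 5 _⟨_⟩_
-- Polymorphic because the same operation joins two halves of a row (`A = ℤ`) and stacks two blocks
-- of rows (`A = ℕ → ℤ`).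
_⟨_⟩_ : {A : Set} → (ℕ → A) → ℕ → (ℕ → A) → ℕ → A
(a ⟨ zero ⟩  b) i       = b i
(a ⟨ suc k ⟩ b) zero    = a zero
(a ⟨ suc k ⟩ b) (suc i) = ((a ∘ suc) ⟨ k ⟩ b) i

⟨⟩-left : {A : Set} {a b : ℕ → A} → ∀ {k i} → i < k → (a ⟨ k ⟩ b) i ≡ a i
⟨⟩-left {k = suc k} {zero}  i<k       = refl
⟨⟩-left {k = suc k} {suc i} (s<s i<k) = ⟨⟩-left i<k

⟨⟩-right : {A : Set} {a b : ℕ → A} → ∀ k i → (a ⟨ k ⟩ b) (k ℕ.+ i) ≡ b i
⟨⟩-right zero    i = refl
⟨⟩-right (suc k) i = ⟨⟩-right k i

-- The common leading rows of M and N carry the rows already chosen in the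
-- expansion of the product along its first rows.
D-product-below : ∀ n k (X M N : Matrix) →
  (∀ i → i < k → ∀ j → M i j ≡ N i j) →
  (∀ i → i < n → ∀ j → M (k ℕ.+ i) j ≡ ∑ n (λ l → X i l ℤ.* N (k ℕ.+ l) j)) →
  D (k ℕ.+ n) M ≡ D n X ℤ.* D (k ℕ.+ n) N
D-product-below zero    k X M N above below = trans
  (D-cong (k ℕ.+ 0) {M} {N} λ i j i<n _ → above i (subst (i <_) (ℕₚ.+-identityʳ k) i<n) j)
  (sym (trans (cong (ℤ._* D (k ℕ.+ 0) N) (D-nil X)) (ℤₚ.*-identityˡ _)))
D-product-below (suc n) k X M N above below = begin
  D s M
    ≡⟨ D-row-∑ s (suc n) (X 0) (λ l → N (k ℕ.+ l)) M (ℕₚ.m<m+n k z<s)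
         (λ j → trans (cong (λ i → M i j) (sym (ℕₚ.+-identityʳ k))) (below 0 z<s j)) ⟩
  ∑ (suc n) (λ l → X 0 l ℤ.* D s (U l))
    ≡⟨ ∑-cong (suc n) (λ l l<n → trans (cong (ℤ._*_ (X 0 l)) (step l l<n))
                                       (rearrange (X 0 l) _ (sgn l) (D s N))) ⟩
  ∑ (suc n) (λ l → D s N ℤ.* (sgn l ℤ.* X 0 l ℤ.* D n (minor l X)))
    ≡⟨ ∑-*ˡ (suc n) (D s N) _ ⟩
  D s N ℤ.* ∑ (suc n) (λ l → sgn l ℤ.* X 0 l ℤ.* D n (minor l X))
    ≡⟨ cong (ℤ._*_ (D s N)) (D-row n X) ⟨
  D s N ℤ.* D (suc n) X
    ≡⟨ ℤₚ.*-comm (D s N) _ ⟩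
  D (suc n) X ℤ.* D s N ∎
  where
  open ≡-Reasoning
  s : ℕ
  s = k ℕ.+ suc n
  rearrange : ∀ x d t y → x ℤ.* (d ℤ.* (t ℤ.* y)) ≡ y ℤ.* (t ℤ.* x ℤ.* d)
  rearrange = solve-∀
  module _ (l : ℕ) where
    U : Matrix
    U = upd k (N (k ℕ.+ l)) M
    -- Row `k` of `U` is now row `k + l` of `N`. Subtracting its multiples from the later rows
    -- removes this row from their expansions, which leaves `minor l X` as the coefficient matrix.
    Q : Matrix
    Q = U ⟨ suc k ⟩ λ i j → U (suc k ℕ.+ i) j ℤ.+ ℤ.- X (suc i) l ℤ.* U k j
    Q-above : ∀ i → i < suc k → ∀ j → Q i j ≡ N (ρ k l i) j
    Q-above i i<1+k@(s≤s i≤k) j with ℕₚ.m≤n⇒m<n∨m≡n i≤k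
    ... | inj₁ i<k  = trans (cong-app (⟨⟩-left i<1+k) j)
                     (trans (cong-app (upd-off k _ M (ℕₚ.<⇒≢ i<k)) j)
                     (trans (above i i<k j) (cong (λ r → N r j) (sym (ρ-below l i<k)))))
    ... | inj₂ refl = trans (cong-app (⟨⟩-left i<1+k) j)
                     (trans (cong-app (upd-at k _ M) j) (cong (λ r → N r j) (sym (ρ-at k l))))
    cancel : ∀ a x y → x ℤ.* y ℤ.+ a ℤ.+ ℤ.- x ℤ.* y ≡ a
    cancel = solve-∀
    Q-below : l < suc n → ∀ i → i < n → ∀ j →
      Q (suc k ℕ.+ i) j ≡ ∑ n (λ l′ → minor l X i l′ ℤ.* N (ρ k l (suc k ℕ.+ l′)) j)
    Q-below l<n i i<n j = begin
      Q (suc k ℕ.+ i) j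
        ≡⟨ cong-app (⟨⟩-right {a = U} (suc k) i) j ⟩
      U (suc k ℕ.+ i) j ℤ.+ ℤ.- X (suc i) l ℤ.* U k j
        ≡⟨ cong₂ (λ a b → a ℤ.+ ℤ.- X (suc i) l ℤ.* b)
             (trans (cong-app (upd-off k _ M (ℕₚ.m+1+n≢m k ∘ trans (ℕₚ.+-suc k i))) j)
             (trans (cong (λ r → M r j) (sym (ℕₚ.+-suc k i)))
             (trans (below (suc i) (s<s i<n) j)
                    (∑-skip (λ l′ → X (suc i) l′ ℤ.* N (k ℕ.+ l′) j) l<n))))
             (cong-app (upd-at k _ M) j) ⟩
      X (suc i) l ℤ.* N (k ℕ.+ l) j ℤ.+ ∑ n (λ l′ → X (suc i) (skip l l′) ℤ.* N (k ℕ.+ skip l l′) j)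
        ℤ.+ ℤ.- X (suc i) l ℤ.* N (k ℕ.+ l) j
        ≡⟨ cancel _ (X (suc i) l) (N (k ℕ.+ l) j) ⟩
      ∑ n (λ l′ → X (suc i) (skip l l′) ℤ.* N (k ℕ.+ skip l l′) j)
        ≡⟨ ∑-cong n (λ l′ _ → cong (λ r → X (suc i) (skip l l′) ℤ.* N r j) (sym (ρ-above k l l′))) ⟩
      ∑ n (λ l′ → minor l X i l′ ℤ.* N (ρ k l (suc k ℕ.+ l′)) j) ∎
    step : l < suc n → D s U ≡ D n (minor l X) ℤ.* (sgn l ℤ.* D s N)
    step l<n = begin
      D s U
        ≡⟨ cong (λ m → D m U) (ℕₚ.+-suc k n) ⟩
      D (suc k ℕ.+ n) U
        ≡⟨ D-clear n (suc k) {k} (λ i → ℤ.- X (suc i) l) Q U (ℕₚ.n<1+n k)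
             (λ i i<k j → cong-app (⟨⟩-left i<k) j)
             (λ i j → cong-app (⟨⟩-right {a = U} (suc k) i) j) ⟨
      D (suc k ℕ.+ n) Q
        -- `N ∘ ρ k l` lists the chosen row at position `k`, hence among the rows shared with `Q`;
        -- moving it back costs `sgn l`, the sign in the expansion of `D (suc n) X`.
        ≡⟨ D-product-below n (suc k) (minor l X) Q (N ∘ ρ k l) Q-above (Q-below l<n) ⟩
      D n (minor l X) ℤ.* D (suc k ℕ.+ n) (N ∘ ρ k l)
        ≡⟨ cong (λ m → D n (minor l X) ℤ.* D m (N ∘ ρ k l)) (ℕₚ.+-suc k n) ⟨
      D n (minor l X) ℤ.* D s (N ∘ ρ k l)
        ≡⟨ cong (ℤ._*_ (D n (minor l X))) (D-rotate s k l N (ℕₚ.+-monoʳ-< k l<n)) ⟩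
      D n (minor l X) ℤ.* (sgn l ℤ.* D s N) ∎

D-product : ∀ n (X M N : Matrix) →
  (∀ i → i < n → ∀ j → M i j ≡ ∑ n (λ l → X i l ℤ.* N l j)) → D n M ≡ D n X ℤ.* D n N
D-product n X M N = D-product-below n 0 X M N (λ _ ())

-- Triangular determinants

D-first-column : ∀ n (M : Matrix) → (∀ r → r < n → M (suc r) 0 ≡ + 0) →
  D (suc n) M ≡ M 0 0 ℤ.* D n (columnMinor 0 M)
D-first-column n M zeros = begin
  D (suc n) M
    ≡⟨ trans (D-column n M) (∑-suc n _) ⟩
  + 1 ℤ.* M 0 0 ℤ.* D n (columnMinor 0 M) ℤ.+
    ∑ n (λ i → sgn (suc i) ℤ.* M (suc i) 0 ℤ.* D n (columnMinor (suc i) M))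
    ≡⟨ cong₂ ℤ._+_ (cong (ℤ._* D n (columnMinor 0 M)) (ℤₚ.*-identityˡ (M 0 0)))
         (∑-zero n (λ i i<n → trans (cong (λ a → sgn (suc i) ℤ.* a ℤ.* D n (columnMinor (suc i) M)) (zeros i i<n))
                                    (vanish (sgn (suc i)) _))) ⟩
  M 0 0 ℤ.* D n (columnMinor 0 M) ℤ.+ + 0
    ≡⟨ ℤₚ.+-identityʳ _ ⟩
  M 0 0 ℤ.* D n (columnMinor 0 M) ∎
  where
  open ≡-Reasoning
  vanish : ∀ s d → s ℤ.* + 0 ℤ.* d ≡ + 0
  vanish = solve-∀

-- Expanding along row 0 drops the last term, whose entry vanishes; every other minor inherits the
-- last column and falls to the induction hypothesis.
D-last-column : ∀ n (M : Matrix) → (∀ r → r < n → M r n ≡ + 0) → D (suc n) M ≡ M n n ℤ.* D n M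
D-last-column zero    M zeros = trans (D-first-column 0 M (λ _ ()))
  (cong (ℤ._*_ (M 0 0)) (trans (D-nil (columnMinor 0 M)) (sym (D-nil M))))
D-last-column (suc n) M zeros = begin
  D (suc (suc n)) M
    ≡⟨ trans (D-row (suc n) M) (∑-last (suc n) _) ⟩
  ∑ (suc n) (λ j → sgn j ℤ.* M 0 j ℤ.* D (suc n) (minor j M)) ℤ.+
    sgn (suc n) ℤ.* M 0 (suc n) ℤ.* D (suc n) (minor (suc n) M)
    ≡⟨ cong₂ ℤ._+_ (∑-cong (suc n) shrink)
         (trans (cong (λ a → sgn (suc n) ℤ.* a ℤ.* D (suc n) (minor (suc n) M)) (zeros 0 z<s))
                (vanish (sgn (suc n)) _)) ⟩
  ∑ (suc n) (λ j → M (suc n) (suc n) ℤ.* (sgn j ℤ.* M 0 j ℤ.* D n (minor j M))) ℤ.+ + 0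
    ≡⟨ trans (ℤₚ.+-identityʳ _) (∑-*ˡ (suc n) (M (suc n) (suc n)) _) ⟩
  M (suc n) (suc n) ℤ.* ∑ (suc n) (λ j → sgn j ℤ.* M 0 j ℤ.* D n (minor j M))
    ≡⟨ cong (ℤ._*_ (M (suc n) (suc n))) (D-row n M) ⟨
  M (suc n) (suc n) ℤ.* D (suc n) M ∎
  where
  open ≡-Reasoning
  vanish : ∀ s d → s ℤ.* + 0 ℤ.* d ≡ + 0
  vanish = solve-∀
  pull : ∀ s a c d → s ℤ.* a ℤ.* (c ℤ.* d) ≡ c ℤ.* (s ℤ.* a ℤ.* d)
  pull = solve-∀
  shrink : ∀ j → j < suc n → sgn j ℤ.* M 0 j ℤ.* D (suc n) (minor j M) ≡
           M (suc n) (suc n) ℤ.* (sgn j ℤ.* M 0 j ℤ.* D n (minor j M))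
  shrink j (s≤s j≤n) = begin
    sgn j ℤ.* M 0 j ℤ.* D (suc n) (minor j M)
      ≡⟨ cong (ℤ._*_ (sgn j ℤ.* M 0 j)) (D-last-column n (minor j M)
           (λ r r<n → trans (cong (M (suc r)) (skip-last j≤n)) (zeros (suc r) (s<s r<n)))) ⟩
    sgn j ℤ.* M 0 j ℤ.* (minor j M n n ℤ.* D n (minor j M))
      ≡⟨ cong (λ k → sgn j ℤ.* M 0 j ℤ.* (M (suc n) k ℤ.* D n (minor j M))) (skip-last j≤n) ⟩
    sgn j ℤ.* M 0 j ℤ.* (M (suc n) (suc n) ℤ.* D n (minor j M))
      ≡⟨ pull (sgn j) (M 0 j) (M (suc n) (suc n)) _ ⟩
    M (suc n) (suc n) ℤ.* (sgn j ℤ.* M 0 j ℤ.* D n (minor j M)) ∎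

-- Strips the last `e` columns one by one. Applied again with `n = 0` it evaluates what is left when
-- that block is triangular too.
D-lowerTriangular-tail : ∀ e n a (M : Matrix) →
  (∀ i → i < e → M (n ℕ.+ i) (n ℕ.+ i) ≡ a) →
  (∀ i → i < e → ∀ r → r < n ℕ.+ i → M r (n ℕ.+ i) ≡ + 0) →
  D (n ℕ.+ e) M ≡ a ℤ.^ e ℤ.* D n M
D-lowerTriangular-tail zero    n a M diag zeros =
  trans (cong (λ m → D m M) (ℕₚ.+-identityʳ n)) (sym (ℤₚ.*-identityˡ (D n M)))
D-lowerTriangular-tail (suc e) n a M diag zeros = begin
  D (n ℕ.+ suc e) M
    ≡⟨ cong (λ m → D m M) (ℕₚ.+-suc n e) ⟩
  D (suc (n ℕ.+ e)) M
    ≡⟨ D-last-column (n ℕ.+ e) M (zeros e (ℕₚ.n<1+n e)) ⟩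
  M (n ℕ.+ e) (n ℕ.+ e) ℤ.* D (n ℕ.+ e) M
    ≡⟨ cong₂ ℤ._*_ (diag e (ℕₚ.n<1+n e))
         (D-lowerTriangular-tail e n a M (λ i i<e → diag i (ℕₚ.m<n⇒m<1+n i<e))
                                         (λ i i<e → zeros i (ℕₚ.m<n⇒m<1+n i<e))) ⟩
  a ℤ.* (a ℤ.^ e ℤ.* D n M)
    ≡⟨ ℤₚ.*-assoc a (a ℤ.^ e) (D n M) ⟨
  a ℤ.^ suc e ℤ.* D n M ∎
  where open ≡-Reasoning

-- Matrices assembled from blocks

⟨⟩-elim : {A : Set} {a b : ℕ → A} (P : ℕ → A → Set) → ∀ m →
  (∀ i → i < m → P i (a i)) → (∀ i → P (m ℕ.+ i) (b i)) → ∀ i → P i ((a ⟨ m ⟩ b) i)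
⟨⟩-elim P zero    left right i       = right i
⟨⟩-elim P (suc m) left right zero    = left 0 z<s
⟨⟩-elim P (suc m) left right (suc i) =
  ⟨⟩-elim (P ∘ suc) m (λ i i<m → left (suc i) (s<s i<m)) right i

-- Allows a matrix factorisation to be checked block by block: `∼` relates a row of the product to
-- its row of coefficients.
⟨⟩-zip : {A B : Set} {a b : ℕ → A} {c d : ℕ → B} (_∼_ : A → B → Set) → ∀ m {n} →
  (∀ i → i < m → a i ∼ c i) → (∀ i → i < n → b i ∼ d i) →
  ∀ i → i < m ℕ.+ n → (a ⟨ m ⟩ b) i ∼ (c ⟨ m ⟩ d) i
⟨⟩-zip _∼_ zero    left right i       i<n       = right i i<n
⟨⟩-zip _∼_ (suc m) left right zero    i<n       = left 0 z<s
⟨⟩-zip _∼_ (suc m) left right (suc i) (s<s i<n) =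
  ⟨⟩-zip _∼_ m (λ i i<m → left (suc i) (s<s i<m)) right i i<n

∑-⟨⟩ : ∀ m n (u v : ℕ → ℤ) (A B : Matrix) c →
  ∑ (m ℕ.+ n) (λ l → (u ⟨ m ⟩ v) l ℤ.* (A ⟨ m ⟩ B) l c) ≡
  ∑ m (λ l → u l ℤ.* A l c) ℤ.+ ∑ n (λ l → v l ℤ.* B l c)
∑-⟨⟩ m n u v A B c = trans (∑-++ m n _) (cong₂ ℤ._+_
  (∑-cong m (λ i i<m → cong₂ ℤ._*_ (⟨⟩-left i<m) (cong-app (⟨⟩-left i<m) c)))
  (∑-cong n (λ i _ → cong₂ ℤ._*_ (⟨⟩-right {a = u} m i) (cong-app (⟨⟩-right {a = A} m i) c))))

∅ : ℕ → ℤ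
∅ _ = + 0

∑-∅ : ∀ n (A : Matrix) c → ∑ n (λ l → ∅ l ℤ.* A l c) ≡ + 0
∑-∅ n A c = ∑-zero n (λ l _ → ℤₚ.*-zeroˡ (A l c))

∑-⟨⟩-right : ∀ m n (v : ℕ → ℤ) (A B : Matrix) c →
  ∑ (m ℕ.+ n) (λ l → (∅ ⟨ m ⟩ v) l ℤ.* (A ⟨ m ⟩ B) l c) ≡ ∑ n (λ l → v l ℤ.* B l c)
∑-⟨⟩-right m n v A B c = trans (∑-⟨⟩ m n ∅ v A B c)
  (trans (cong (ℤ._+ ∑ n (λ l → v l ℤ.* B l c)) (∑-∅ m A c)) (ℤₚ.+-identityˡ _))

∑-⟨⟩-left : ∀ m n (u : ℕ → ℤ) (A B : Matrix) c →
  ∑ (m ℕ.+ n) (λ l → (u ⟨ m ⟩ ∅) l ℤ.* (A ⟨ m ⟩ B) l c) ≡ ∑ m (λ l → u l ℤ.* A l c)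
∑-⟨⟩-left m n u A B c = trans (∑-⟨⟩ m n u ∅ A B c)
  (trans (cong (ℤ._+_ (∑ m (λ l → u l ℤ.* A l c))) (∑-∅ n B c)) (ℤₚ.+-identityʳ _))

-- The identity matrix. Its row `i` also serves as the coefficient sequence of the monomial x^i, so
-- `δ 0` is the constant 1.
δ : Matrix
δ zero    zero    = + 1
δ zero    (suc j) = + 0
δ (suc i) zero    = + 0
δ (suc i) (suc j) = δ i j

δ-diag : ∀ i → δ i i ≡ + 1
δ-diag zero    = refl
δ-diag (suc i) = δ-diag i

δ-off : ∀ {i j} → i ≢ j → δ i j ≡ + 0
δ-off {zero}  {zero}  i≢j = contradiction refl i≢j
δ-off {zero}  {suc j} i≢j = refl
δ-off {suc i} {zero}  i≢j = refl
δ-off {suc i} {suc j} i≢j = δ-off (i≢j ∘ cong suc)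

δ-skip : ∀ i j → δ i (skip i j) ≡ + 0
δ-skip zero    j       = refl
δ-skip (suc i) zero    = refl
δ-skip (suc i) (suc j) = δ-skip i j

δ-sym : ∀ i j → δ i j ≡ δ j i
δ-sym zero    zero    = refl
δ-sym zero    (suc j) = refl
δ-sym (suc i) zero    = refl
δ-sym (suc i) (suc j) = δ-sym i j

∑-δ : ∀ n {i} (h : ℕ → ℤ) → i < n → ∑ n (λ l → δ i l ℤ.* h l) ≡ h i
∑-δ (suc n) {i} h i<n = begin
  ∑ (suc n) (λ l → δ i l ℤ.* h l)
    ≡⟨ ∑-skip (λ l → δ i l ℤ.* h l) i<n ⟩
  δ i i ℤ.* h i ℤ.+ ∑ n (λ l → δ i (skip i l) ℤ.* h (skip i l))
    ≡⟨ cong₂ ℤ._+_ (trans (cong (ℤ._* h i) (δ-diag i)) (ℤₚ.*-identityˡ (h i)))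
         (∑-zero n (λ l _ → trans (cong (ℤ._* h (skip i l)) (δ-skip i l)) (ℤₚ.*-zeroˡ (h (skip i l))))) ⟩
  h i ℤ.+ + 0
    ≡⟨ ℤₚ.+-identityʳ (h i) ⟩
  h i ∎
  where open ≡-Reasoning

-- Each of the first `m` columns is a unit vector; expanding along it removes its own row, and with
-- it a row of `P`, until only `C` is left.
D-unitriangular-block : ∀ m n (P C : Matrix) →
  D (m ℕ.+ n) ((λ k → δ k ⟨ m ⟩ P k) ⟨ m ⟩ (λ i → ∅ ⟨ m ⟩ C i)) ≡ D n C
D-unitriangular-block zero    n P C = refl
D-unitriangular-block (suc m) n P C = begin
  D (suc (m ℕ.+ n)) M
    ≡⟨ D-first-column (m ℕ.+ n) M
         (λ r _ → ⟨⟩-elim (λ _ (row : ℕ → ℤ) → row 0 ≡ + 0) m (λ _ _ → refl) (λ _ → refl) r) ⟩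
  + 1 ℤ.* D (m ℕ.+ n) (columnMinor 0 M)
    ≡⟨ ℤₚ.*-identityˡ _ ⟩
  D (m ℕ.+ n) (columnMinor 0 M)
    ≡⟨ D-cong (m ℕ.+ n) (λ i j i<n _ →
         ⟨⟩-zip (λ (row row′ : ℕ → ℤ) → ∀ j → row (suc j) ≡ row′ j) m (λ _ _ _ → refl) (λ _ _ _ → refl) i i<n j) ⟩
  D (m ℕ.+ n) ((λ k → δ k ⟨ m ⟩ P (suc k)) ⟨ m ⟩ (λ i → ∅ ⟨ m ⟩ C i))
    ≡⟨ D-unitriangular-block m n (P ∘ suc) C ⟩
  D n C ∎
  where
  open ≡-Reasoning
  M : Matrix
  M = (λ k → δ k ⟨ suc m ⟩ P k) ⟨ suc m ⟩ (λ i → ∅ ⟨ suc m ⟩ C i)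

-- Polynomials as coefficient sequences

shift : ℕ → (ℕ → ℤ) → ℕ → ℤ
shift zero    a k       = a k
shift (suc s) a zero    = + 0
shift (suc s) a (suc k) = shift s a k

Vanish : ℕ → (ℕ → ℤ) → Set
Vanish N a = ∀ k → N ≤ k → a k ≡ + 0

shift-cong : ∀ s {a b : ℕ → ℤ} → (∀ k → a k ≡ b k) → ∀ k → shift s a k ≡ shift s b k
shift-cong zero    eq k       = eq k
shift-cong (suc s) eq zero    = refl
shift-cong (suc s) eq (suc k) = shift-cong s eq k

shift-below : ∀ {s k} a → k < s → shift s a k ≡ + 0
shift-below {suc s} {zero}  a k<s       = refl
shift-below {suc s} {suc k} a (s<s k<s) = shift-below a k<s

shift-+ : ∀ s a k → shift s a (s ℕ.+ k) ≡ a k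
shift-+ zero    a k = refl
shift-+ (suc s) a k = shift-+ s a k

Vanish-shift : ∀ s {N a} → Vanish N a → Vanish (s ℕ.+ N) (shift s a)
Vanish-shift zero    va k       s+N≤k       = va k s+N≤k
Vanish-shift (suc s) va (suc k) (s≤s s+N≤k) = Vanish-shift s va k s+N≤k

Vanish-≤ : ∀ {M N a} → M ≤ N → Vanish M a → Vanish N a
Vanish-≤ M≤N va k N≤k = va k (ℕₚ.≤-trans M≤N N≤k)

shift-δ : ∀ l N (b : ℕ → ℤ) k → k < N → shift l b k ≡ ∑ N (λ t → b t ℤ.* δ (l ℕ.+ t) k)
shift-δ zero N b k k<N = sym (trans
  (∑-cong N (λ t _ → trans (ℤₚ.*-comm (b t) (δ t k)) (cong (ℤ._* b t) (δ-sym t k))))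
  (∑-δ N b k<N))
shift-δ (suc l) N b zero    k<N = sym (∑-zero N (λ t _ → ℤₚ.*-zeroʳ (b t)))
shift-δ (suc l) N b (suc k) k<N = shift-δ l N b k (ℕₚ.<-trans (ℕₚ.n<1+n k) k<N)

infixl 7 _⊛_
-- The Cauchy product, written as a combination of shifts of `b` so that a product of polynomials is
-- already a combination of Sylvester rows.
_⊛_ : (ℕ → ℤ) → (ℕ → ℤ) → ℕ → ℤ
(a ⊛ b) k = ∑ (suc k) (λ l → a l ℤ.* shift l b k)

-- Past `k` the shifts vanish, past `N` the coefficients do. A matrix product needs this form, whose
-- number of terms is the same in every column.
⊛-∑ : ∀ N {a} b k → Vanish N a → (a ⊛ b) k ≡ ∑ N (λ l → a l ℤ.* shift l b k)
⊛-∑ N {a} b k va = ∑-support (suc k) N (λ l → a l ℤ.* shift l b k)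
  (λ l k<l → trans (cong (ℤ._*_ (a l)) (shift-below b k<l)) (ℤₚ.*-zeroʳ (a l)))
  (λ l N≤l → trans (cong (ℤ._* shift l b k) (va l N≤l)) (ℤₚ.*-zeroˡ (shift l b k)))

⊛-shift : ∀ s a b k → (shift s a ⊛ b) k ≡ shift s (a ⊛ b) k
⊛-shift zero    a b k    = refl
⊛-shift (suc s) a b zero = trans (∑-suc 0 _)
  (cong₂ ℤ._+_ (ℤₚ.*-zeroˡ (b 0)) (∑-nil _))
⊛-shift (suc s) a b (suc k) = trans (∑-suc (suc k) _)
  (trans (cong (ℤ._+ (shift s a ⊛ b) k) (ℤₚ.*-zeroˡ (b (suc k))))
  (trans (ℤₚ.+-identityˡ _) (⊛-shift s a b k)))

-- Unlike the definition, this form treats both factors alike, with `δ` selecting the pairs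
-- `l + t = k`; commutativity becomes a swap of sums.
⊛-double : ∀ a b k →
  (a ⊛ b) k ≡ ∑ (suc k) (λ l → ∑ (suc k) (λ t → a l ℤ.* (b t ℤ.* δ (l ℕ.+ t) k)))
⊛-double a b k = ∑-cong (suc k) (λ l _ → trans
  (cong (ℤ._*_ (a l)) (shift-δ l (suc k) b k (ℕₚ.n<1+n k)))
  (sym (∑-*ˡ (suc k) (a l) _)))

⊛-comm : ∀ a b k → (a ⊛ b) k ≡ (b ⊛ a) k
⊛-comm a b k = begin
  (a ⊛ b) k
    ≡⟨ ⊛-double a b k ⟩
  ∑ (suc k) (λ l → ∑ (suc k) (λ t → a l ℤ.* (b t ℤ.* δ (l ℕ.+ t) k)))
    ≡⟨ ∑-swap (suc k) (suc k) _ ⟩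
  ∑ (suc k) (λ t → ∑ (suc k) (λ l → a l ℤ.* (b t ℤ.* δ (l ℕ.+ t) k)))
    ≡⟨ ∑-cong (suc k) (λ t _ → ∑-cong (suc k) (λ l _ →
         trans (exchange (a l) (b t) (δ (l ℕ.+ t) k))
               (cong (λ s → b t ℤ.* (a l ℤ.* δ s k)) (ℕₚ.+-comm l t)))) ⟩
  ∑ (suc k) (λ t → ∑ (suc k) (λ l → b t ℤ.* (a l ℤ.* δ (t ℕ.+ l) k)))
    ≡⟨ ⊛-double b a k ⟨
  (b ⊛ a) k ∎
  where
  open ≡-Reasoning
  exchange : ∀ x y z → x ℤ.* (y ℤ.* z) ≡ y ℤ.* (x ℤ.* z)
  exchange = solve-∀

⊛-top : ∀ {u v a b} → Vanish (suc u) a → Vanish (suc v) b → (a ⊛ b) (u ℕ.+ v) ≡ a u ℤ.* b v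
⊛-top {u} {v} {a} {b} va vb = begin
  (a ⊛ b) (u ℕ.+ v)
    ≡⟨ ⊛-∑ (suc u) b (u ℕ.+ v) va ⟩
  ∑ (suc u) (λ l → a l ℤ.* shift l b (u ℕ.+ v))
    ≡⟨ ∑-last u _ ⟩
  ∑ u (λ l → a l ℤ.* shift l b (u ℕ.+ v)) ℤ.+ a u ℤ.* shift u b (u ℕ.+ v)
    ≡⟨ cong₂ ℤ._+_
         (∑-zero u (λ l l<u → trans
           (cong (ℤ._*_ (a l)) (Vanish-shift l vb (u ℕ.+ v)
             (ℕₚ.≤-trans (ℕₚ.≤-reflexive (ℕₚ.+-suc l v)) (ℕₚ.+-monoˡ-≤ v l<u))))
           (ℤₚ.*-zeroʳ (a l))))
         (cong (ℤ._*_ (a u)) (shift-+ u b v)) ⟩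
  + 0 ℤ.+ a u ℤ.* b v
    ≡⟨ ℤₚ.+-identityˡ _ ⟩
  a u ℤ.* b v ∎
  where open ≡-Reasoning

Vanish-⊛ : ∀ {u v a b} → Vanish (suc u) a → Vanish (suc v) b → Vanish (suc (u ℕ.+ v)) (a ⊛ b)
Vanish-⊛ {u} {v} {a} {b} va vb k u+v<k = trans (⊛-∑ (suc u) b k va)
  (∑-zero (suc u) (λ { l (s≤s l≤u) → trans
    (cong (ℤ._*_ (a l)) (Vanish-shift l vb k
      (ℕₚ.≤-trans (ℕₚ.≤-reflexive (ℕₚ.+-suc l v)) (ℕₚ.≤-trans (s≤s (ℕₚ.+-monoˡ-≤ v l≤u)) u+v<k))))
    (ℤₚ.*-zeroʳ (a l)) }))

-- The resultant

-- Only the number of shifts of `f` is fixed; the shifts of `g` continue indefinitely. The Sylvester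
-- matrix and its enlargement by `e` more shifts of `g` are therefore one matrix read at two sizes.
sylvesterRows : ℕ → (ℕ → ℤ) → (ℕ → ℤ) → Matrix
sylvesterRows n f g = (λ i → shift i f) ⟨ n ⟩ (λ i → shift i g)

resultant : ℕ → ℕ → (ℕ → ℤ) → (ℕ → ℤ) → ℤ
resultant m n f g = D (m ℕ.+ n) (sylvesterRows n f g)

if-⟨⟩ : ∀ n (a b : ℕ → ℤ) i → (if i ℕ.<ᵇ n then a i else b (i ℕ.∸ n)) ≡ (a ⟨ n ⟩ b) i
if-⟨⟩ zero    a b i       = refl
if-⟨⟩ (suc n) a b zero    = refl
if-⟨⟩ (suc n) a b (suc i) = if-⟨⟩ n (a ∘ suc) b i

⟨⟩-app : ∀ n (A B : Matrix) i k → ((λ i → A i k) ⟨ n ⟩ (λ i → B i k)) i ≡ (A ⟨ n ⟩ B) i k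
⟨⟩-app zero    A B i       k = refl
⟨⟩-app (suc n) A B zero    k = refl
⟨⟩-app (suc n) A B (suc i) k = ⟨⟩-app n (A ∘ suc) B i k

shiftRow≡shift : ∀ h s k → shiftRow h s k ≡ shift s (coeff h) k
shiftRow≡shift h zero          k       = refl
shiftRow≡shift h (suc s)       zero    = refl
shiftRow≡shift h (suc zero)    (suc k) = refl
shiftRow≡shift h (suc (suc s)) (suc k) = shiftRow≡shift h (suc s) k

Res≡resultant : ∀ f g → Res f g ≡ resultant (deg f) (deg g) (coeff f) (coeff g)
Res≡resultant f g = det≡D (deg f ℕ.+ deg g) λ i k →
  trans (if-⟨⟩ (deg g) (λ i → shiftRow f i (toℕ k)) (λ i → shiftRow g i (toℕ k)) (toℕ i))
  (trans (⟨⟩-app (deg g) (shiftRow f) (shiftRow g) (toℕ i) (toℕ k))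
         (⟨⟩-elim {b = shiftRow g} (λ i row → row (toℕ k) ≡ sylvesterRows (deg g) (coeff f) (coeff g) i (toℕ k)) (deg g)
           (λ i i<n → trans (shiftRow≡shift f i (toℕ k)) (sym (cong-app (⟨⟩-left i<n) (toℕ k))))
           (λ i → trans (shiftRow≡shift g i (toℕ k))
             (sym (cong-app (⟨⟩-right {a = λ i → shift i (coeff f)} (deg g) i) (toℕ k))))
           (toℕ i)))

-- The two row blocks trade places, so `X` is a permutation matrix. Its determinant is kept as an
-- unspecified integer, which is enough for divisibility.
resultant-swap : ∀ m n f g → ∃[ c ] resultant n m g f ≡ c ℤ.* resultant m n f g
resultant-swap m n f g = D (n ℕ.+ m) X , (begin
  D (n ℕ.+ m) (sylvesterRows m g f)
    ≡⟨ cong (λ s → D s (sylvesterRows m g f)) (ℕₚ.+-comm n m) ⟩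
  D (m ℕ.+ n) (sylvesterRows m g f)
    ≡⟨ D-product (m ℕ.+ n) X _ _ (⟨⟩-zip
         (λ (y x : ℕ → ℤ) → ∀ c → y c ≡ ∑ (m ℕ.+ n) (λ l → x l ℤ.* sylvesterRows n f g l c)) m
         (λ i i<m c → sym (trans (size (∅ ⟨ n ⟩ δ i) c)
           (trans (∑-⟨⟩-right n m (δ i) _ _ c) (∑-δ m (λ l → shift l g c) i<m))))
         (λ i i<n c → sym (trans (size (δ i ⟨ n ⟩ ∅) c)
           (trans (∑-⟨⟩-left n m (δ i) _ _ c) (∑-δ n (λ l → shift l f c) i<n))))) ⟩
  D (m ℕ.+ n) X ℤ.* resultant m n f g
    ≡⟨ cong (λ s → D s X ℤ.* resultant m n f g) (ℕₚ.+-comm m n) ⟩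
  D (n ℕ.+ m) X ℤ.* resultant m n f g ∎)
  where
  open ≡-Reasoning
  X : Matrix
  X = (λ i → ∅ ⟨ n ⟩ δ i) ⟨ m ⟩ (λ i → δ i ⟨ n ⟩ ∅)
  size : ∀ (x : ℕ → ℤ) c →
    ∑ (m ℕ.+ n) (λ l → x l ℤ.* sylvesterRows n f g l c) ≡
    ∑ (n ℕ.+ m) (λ l → x l ℤ.* sylvesterRows n f g l c)
  size x c = cong (λ s → ∑ s (λ l → x l ℤ.* sylvesterRows n f g l c)) (ℕₚ.+-comm m n)

-- The Bezout identity multiplied by x^s.
shift-const : ∀ r {u v : ℕ → ℤ} → (∀ k → u k ℤ.+ v k ≡ r ℤ.* δ 0 k) →
  ∀ s k → shift s u k ℤ.+ shift s v k ≡ r ℤ.* δ s k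
shift-const r eq zero    k       = eq k
shift-const r eq (suc s) zero    = sym (ℤₚ.*-zeroʳ r)
shift-const r eq (suc s) (suc k) = shift-const r eq s k

-- Y = X B = W Z, where B is the block of sylvesterRows n f g of size n + (m + e).
module BezoutRows (m n e e′ : ℕ) (f g p q : ℕ → ℤ) (r : ℤ)
  (vf : Vanish (suc m) f) (vg : Vanish (suc n) g) (vp : Vanish (suc e′) p) (vq : Vanish (suc e) q)
  (degrees : n ℕ.+ e ≡ m ℕ.+ e′)
  (bezout : ∀ k → (p ⊛ f) k ℤ.+ (q ⊛ g) k ≡ r ℤ.* δ 0 k) where

  open ≡-Reasoning

  N : ℕ
  N = m ℕ.+ (n ℕ.+ e)

  F G : Matrix
  F i = shift i f
  G i = shift i g

  -- Rows of `X` and `W` are the coordinates of the rows of `Y` in the two systems. The rows x^i f g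
  -- have coordinates from `f` on the shifts of `g`, or from `g` on the shifts of `f`. The top block
  -- of `W` is the Bezout identity solved for q g, hence `- p` beside the identity. Apart from its
  -- unit rows, `X` is a Sylvester matrix of `f` and `q`.
  Y X W Z : Matrix
  Y = (λ k → shift k (q ⊛ g)) ⟨ m ⟩ F ⟨ n ⟩ (λ i → shift i (f ⊛ g))
  X = (λ k → ∅ ⟨ n ⟩ shift k q) ⟨ m ⟩ (λ i → δ i ⟨ n ⟩ ∅) ⟨ n ⟩ (λ i → ∅ ⟨ n ⟩ shift i f)
  W = (λ k → δ k ⟨ m ⟩ (λ c → ℤ.- (+ 1) ℤ.* shift k p c)) ⟨ m ⟩ (λ i → ∅ ⟨ m ⟩ (δ ⟨ n ⟩ G) i)
  Z = (λ k c → r ℤ.* δ k c) ⟨ m ⟩ F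

  shift-⊛-∑ : ∀ K s {M a} b c → Vanish M a → s ℕ.+ M ≤ K →
    shift s (a ⊛ b) c ≡ ∑ K (λ l → shift s a l ℤ.* shift l b c)
  shift-⊛-∑ K s {a = a} b c va s+M≤K =
    trans (sym (⊛-shift s a b c)) (⊛-∑ K b c (Vanish-≤ s+M≤K (Vanish-shift s va)))

  -- A degree count: for `i < a`, multiplying degree at most `b` by x^i stays below `a + b`.
  index≤ : ∀ {i} a b → i < a → i ℕ.+ suc b ≤ a ℕ.+ b
  index≤ {i} a b i<a = ℕₚ.≤-trans (ℕₚ.≤-reflexive (ℕₚ.+-suc i b)) (ℕₚ.+-monoˡ-≤ b i<a)

  index≤′ : ∀ {i} a b → i < b → i ℕ.+ suc a ≤ a ℕ.+ b
  index≤′ {i} a b i<b = subst (i ℕ.+ suc a ≤_) (ℕₚ.+-comm b a) (index≤ b a i<b)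

  N-swap : N ≡ n ℕ.+ (m ℕ.+ e)
  N-swap = swap m n e
    where
    swap : ∀ m n e → m ℕ.+ (n ℕ.+ e) ≡ n ℕ.+ (m ℕ.+ e)
    swap = ℕ-Solver.solve-∀

  Y≡XB : ∀ i → i < N → ∀ c → Y i c ≡ ∑ (n ℕ.+ (m ℕ.+ e)) (λ l → X i l ℤ.* sylvesterRows n f g l c)
  Y≡XB = ⟨⟩-zip _∼_ m
    (λ k k<m c → trans (shift-⊛-∑ (m ℕ.+ e) k g c vq (index≤ m e k<m))
                       (sym (∑-⟨⟩-right n (m ℕ.+ e) (shift k q) F G c)))
    (⟨⟩-zip _∼_ n
      (λ i i<n c → sym (trans (∑-⟨⟩-left n (m ℕ.+ e) (δ i) F G c) (∑-δ n (λ l → F l c) i<n)))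
      (λ i i<e c → trans (shift-⊛-∑ (m ℕ.+ e) i g c vf (index≤′ m e i<e))
                         (sym (∑-⟨⟩-right n (m ℕ.+ e) (shift i f) F G c))))
    where
    _∼_ : (ℕ → ℤ) → (ℕ → ℤ) → Set
    y ∼ x = ∀ c → y c ≡ ∑ (n ℕ.+ (m ℕ.+ e)) (λ l → x l ℤ.* sylvesterRows n f g l c)

  Y≡WZ : ∀ i → i < N → ∀ c → Y i c ≡ ∑ N (λ l → W i l ℤ.* Z l c)
  Y≡WZ = ⟨⟩-zip _∼_ m bezoutRow
    (⟨⟩-zip (λ y x → y ∼ (∅ ⟨ m ⟩ x)) n
      (λ i i<n c → sym (trans (∑-⟨⟩-right m (n ℕ.+ e) (δ i) _ F c)
                              (∑-δ (n ℕ.+ e) (λ l → F l c) (ℕₚ.<-≤-trans i<n (ℕₚ.m≤m+n n e)))))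
      -- `Y` lists this product as `f ⊛ g`, a combination of shifts of `g`; here shifts of `f` are
      -- wanted, so the factors are exchanged.
      (λ i i<e c → trans (shift-cong i (⊛-comm f g) c)
                  (trans (shift-⊛-∑ (n ℕ.+ e) i f c vg (index≤′ n e i<e))
                         (sym (∑-⟨⟩-right m (n ℕ.+ e) (G i) _ F c)))))
    where
    _∼_ : (ℕ → ℤ) → (ℕ → ℤ) → Set
    y ∼ x = ∀ c → y c ≡ ∑ N (λ l → x l ℤ.* Z l c)
    move : ∀ {a b x} → a ℤ.+ b ≡ x → b ≡ x ℤ.+ ℤ.- (+ 1) ℤ.* a
    move {a} {b} refl = ring a b
      where
      ring : ∀ a b → b ≡ a ℤ.+ b ℤ.+ ℤ.- (+ 1) ℤ.* a
      ring = solve-∀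
    bezoutRow : ∀ k → k < m → shift k (q ⊛ g) ∼ (δ k ⟨ m ⟩ (λ c → ℤ.- (+ 1) ℤ.* shift k p c))
    bezoutRow k k<m c = begin
      shift k (q ⊛ g) c
        ≡⟨ move (shift-const r bezout k c) ⟩
      r ℤ.* δ k c ℤ.+ ℤ.- (+ 1) ℤ.* shift k (p ⊛ f) c
        ≡⟨ cong₂ ℤ._+_ (sym (∑-δ m (λ l → r ℤ.* δ l c) k<m))
             (trans (cong (ℤ._*_ (ℤ.- (+ 1))) (shift-⊛-∑ (n ℕ.+ e) k f c vp
                       -- x^k p has degree at most `k + e′`, which is below `m + e′ = n + e`, so the
                       -- shifts of `f` present in `Z` suffice.
                       (subst (k ℕ.+ suc e′ ≤_) (sym degrees) (index≤ m e′ k<m))))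
             (trans (sym (∑-*ˡ (n ℕ.+ e) (ℤ.- (+ 1)) _))
                    (∑-cong (n ℕ.+ e) (λ l _ → sym (ℤₚ.*-assoc (ℤ.- (+ 1)) (shift k p l) (F l c)))))) ⟩
      ∑ m (λ l → δ k l ℤ.* (r ℤ.* δ l c)) ℤ.+
        ∑ (n ℕ.+ e) (λ l → ℤ.- (+ 1) ℤ.* shift k p l ℤ.* F l c)
        ≡⟨ ∑-⟨⟩ m (n ℕ.+ e) (δ k) (λ c → ℤ.- (+ 1) ℤ.* shift k p c) (λ k c → r ℤ.* δ k c) F c ⟨
      ∑ N (λ l → (δ k ⟨ m ⟩ (λ c → ℤ.- (+ 1) ℤ.* shift k p c)) l ℤ.* Z l c) ∎

  -- `Z` is lower triangular: r x^k occupies column `k` alone, and x^i f ends in column `m + i` with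
  -- its leading coefficient.
  D-Z : D N Z ≡ f m ℤ.^ (n ℕ.+ e) ℤ.* r ℤ.^ m
  D-Z = trans
    (D-lowerTriangular-tail (n ℕ.+ e) m (f m) Z
      (λ i _ → trans (cong-app (⟨⟩-right m i) (m ℕ.+ i))
              (trans (cong (F i) (ℕₚ.+-comm m i)) (shift-+ i f m)))
      (λ i _ → ⟨⟩-elim {b = F} (λ l row → l < m ℕ.+ i → row (m ℕ.+ i) ≡ + 0) m
        (λ l l<m _ → trans (cong (ℤ._*_ r) (δ-off (ℕₚ.<⇒≢ (ℕₚ.<-≤-trans l<m (ℕₚ.m≤m+n m i))))) (ℤₚ.*-zeroʳ r))
        (λ l m+l<m+i → Vanish-shift l vf (m ℕ.+ i) (index≤′ m i (ℕₚ.+-cancelˡ-< m l i m+l<m+i)))))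
    (cong (ℤ._*_ (f m ℤ.^ (n ℕ.+ e))) (begin
      D m Z
        ≡⟨ D-lowerTriangular-tail m 0 r Z
             (λ i i<m → trans (cong-app (⟨⟩-left i<m) i)
                       (trans (cong (ℤ._*_ r) (δ-diag i)) (ℤₚ.*-identityʳ r)))
             (λ i i<m l l<i → trans (cong-app (⟨⟩-left (ℕₚ.<-trans l<i i<m)) i)
                       (trans (cong (ℤ._*_ r) (δ-off (ℕₚ.<⇒≢ l<i))) (ℤₚ.*-zeroʳ r))) ⟩
      r ℤ.^ m ℤ.* D 0 Z
        ≡⟨ trans (cong (ℤ._*_ (r ℤ.^ m)) (D-nil Z)) (ℤₚ.*-identityʳ _) ⟩
      r ℤ.^ m ∎))

  G-tail-diag : ∀ (A : Matrix) k i → (A ⟨ n ⟩ G) (n ℕ.+ (k ℕ.+ i)) (n ℕ.+ (k ℕ.+ i)) ≡ g n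
  G-tail-diag A k i = trans (cong-app (⟨⟩-right {a = A} n (k ℕ.+ i)) _)
    (trans (cong (G (k ℕ.+ i)) (ℕₚ.+-comm n (k ℕ.+ i))) (shift-+ (k ℕ.+ i) g n))

  G-tail-zero : ∀ (A : Matrix) i → (∀ l → l < n → A l (n ℕ.+ i) ≡ + 0) →
    ∀ l → l < n ℕ.+ i → (A ⟨ n ⟩ G) l (n ℕ.+ i) ≡ + 0
  G-tail-zero A i zeros = ⟨⟩-elim {b = G} (λ l row → l < n ℕ.+ i → row (n ℕ.+ i) ≡ + 0) n
    (λ l l<n _ → zeros l l<n)
    (λ l n+l<n+i → Vanish-shift l vg (n ℕ.+ i) (index≤′ n i (ℕₚ.+-cancelˡ-< n l i n+l<n+i)))

  -- Once the identity block is stripped, `δ ⟨ n ⟩ G` is lower triangular with `n` ones and then `e`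
  -- copies of `g n` on the diagonal.
  D-W : D N W ≡ g n ℤ.^ e
  D-W = begin
    D N W
      ≡⟨ D-unitriangular-block m (n ℕ.+ e) (λ k c → ℤ.- (+ 1) ℤ.* shift k p c) (δ ⟨ n ⟩ G) ⟩
    D (n ℕ.+ e) (δ ⟨ n ⟩ G)
      ≡⟨ D-lowerTriangular-tail e n (g n) (δ ⟨ n ⟩ G)
           (λ i _ → G-tail-diag δ 0 i)
           (λ i _ → G-tail-zero δ i (λ l l<n → δ-off (ℕₚ.<⇒≢ (ℕₚ.<-≤-trans l<n (ℕₚ.m≤m+n n i))))) ⟩
    g n ℤ.^ e ℤ.* D n (δ ⟨ n ⟩ G)
      ≡⟨ cong (ℤ._*_ (g n ℤ.^ e)) (trans (D-lowerTriangular-tail n 0 (+ 1) (δ ⟨ n ⟩ G)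
           (λ i i<n → trans (cong-app (⟨⟩-left i<n) i) (δ-diag i))
           (λ i i<n l l<i → trans (cong-app (⟨⟩-left (ℕₚ.<-trans l<i i<n)) i) (δ-off (ℕₚ.<⇒≢ l<i))))
           (cong₂ ℤ._*_ (ℤₚ.^-zeroˡ n) (D-nil (δ ⟨ n ⟩ G)))) ⟩
    g n ℤ.^ e ℤ.* (+ 1 ℤ.* + 1)
      ≡⟨ ℤₚ.*-identityʳ _ ⟩
    g n ℤ.^ e ∎

  -- Each extra shift of `g` has its leading coefficient in a column that no earlier row reaches.
  D-B : D (n ℕ.+ (m ℕ.+ e)) (sylvesterRows n f g) ≡ g n ℤ.^ e ℤ.* resultant m n f g
  D-B = begin
    D (n ℕ.+ (m ℕ.+ e)) (F ⟨ n ⟩ G)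
      ≡⟨ cong (λ s → D s (F ⟨ n ⟩ G)) (ℕₚ.+-assoc n m e) ⟨
    D (n ℕ.+ m ℕ.+ e) (F ⟨ n ⟩ G)
      ≡⟨ D-lowerTriangular-tail e (n ℕ.+ m) (g n) (F ⟨ n ⟩ G)
           (λ i _ → trans (cong (λ s → (F ⟨ n ⟩ G) s s) (ℕₚ.+-assoc n m i)) (G-tail-diag F m i))
           (λ i _ l l<n+m+i → trans (cong ((F ⟨ n ⟩ G) l) (ℕₚ.+-assoc n m i))
             (G-tail-zero F (m ℕ.+ i)
               (λ l l<n → Vanish-shift l vf _
                 (ℕₚ.≤-trans (index≤ n m l<n) (ℕₚ.+-monoʳ-≤ n (ℕₚ.m≤m+n m i))))
               l (subst (l <_) (ℕₚ.+-assoc n m i) l<n+m+i))) ⟩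
    g n ℤ.^ e ℤ.* D (n ℕ.+ m) (F ⟨ n ⟩ G)
      ≡⟨ cong (λ s → g n ℤ.^ e ℤ.* D s (F ⟨ n ⟩ G)) (ℕₚ.+-comm n m) ⟩
    g n ℤ.^ e ℤ.* resultant m n f g ∎

  -- The factor `g n ^ e` occurs in both `D-W` and `D-B`; after cancellation the quotient is
  -- `D N X`, an integer because `X` has integer entries.
  resultant-divides : g n ≢ + 0 → ∃[ c ] f m ℤ.^ (n ℕ.+ e) ℤ.* r ℤ.^ m ≡ c ℤ.* resultant m n f g
  resultant-divides gn≢0 = D N X ,
    ℤₚ.*-cancelˡ-≡ (g n ℤ.^ e) _ _ {{ℤ.≢-nonZero (gn≢0 ∘ ℤₚ.i^n≡0⇒i≡0 (g n) e)}} (begin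
      g n ℤ.^ e ℤ.* (f m ℤ.^ (n ℕ.+ e) ℤ.* r ℤ.^ m)
        ≡⟨ cong₂ ℤ._*_ D-W D-Z ⟨
      D N W ℤ.* D N Z
        ≡⟨ D-product N W Y Z Y≡WZ ⟨
      D N Y
        ≡⟨ D-product N X Y (F ⟨ n ⟩ G) (λ i i<N c → trans (Y≡XB i i<N c)
             (cong (λ s → ∑ s (λ l → X i l ℤ.* (F ⟨ n ⟩ G) l c)) (sym N-swap))) ⟩
      D N X ℤ.* D N (F ⟨ n ⟩ G)
        ≡⟨ cong (ℤ._*_ (D N X)) (trans (cong (λ s → D s (F ⟨ n ⟩ G)) N-swap) D-B) ⟩
      D N X ℤ.* (g n ℤ.^ e ℤ.* resultant m n f g)
        ≡⟨ exchange (D N X) (g n ℤ.^ e) _ ⟩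
      g n ℤ.^ e ℤ.* (D N X ℤ.* resultant m n f g) ∎)
    where
    exchange : ∀ x y z → x ℤ.* (y ℤ.* z) ≡ y ℤ.* (x ℤ.* z)
    exchange = solve-∀

-- Coefficient lists: products, degrees and leading coefficients

coeff-+ : ∀ p q k → coeff (p +ₚ q) k ≡ coeff p k ℤ.+ coeff q k
coeff-+ []      q       k       = sym (ℤₚ.+-identityˡ (coeff q k))
coeff-+ (a ∷ p) []      k       = sym (ℤₚ.+-identityʳ (coeff (a ∷ p) k))
coeff-+ (a ∷ p) (b ∷ q) zero    = refl
coeff-+ (a ∷ p) (b ∷ q) (suc k) = coeff-+ p q k

coeff-map-* : ∀ a q k → coeff (map (a ℤ.*_) q) k ≡ a ℤ.* coeff q k
coeff-map-* a []      k       = sym (ℤₚ.*-zeroʳ a)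
coeff-map-* a (b ∷ q) zero    = refl
coeff-map-* a (b ∷ q) (suc k) = coeff-map-* a q k

coeff-* : ∀ p q k → coeff (p *ₚ q) k ≡ (coeff p ⊛ coeff q) k
coeff-* []      q k = sym (∑-zero (suc k) (λ l _ → ℤₚ.*-zeroˡ (shift l (coeff q) k)))
coeff-* (a ∷ p) q k = trans (coeff-+ (map (a ℤ.*_) q) (+ 0 ∷ p *ₚ q) k)
  (trans (cong₂ ℤ._+_ (coeff-map-* a q k) (tail k)) (sym (∑-suc k _)))
  where
  tail : ∀ k → coeff (+ 0 ∷ p *ₚ q) k ≡ ∑ k (λ l → coeff p l ℤ.* shift (suc l) (coeff q) k)
  tail zero    = sym (∑-nil _)
  tail (suc k) = coeff-* p q k

isZeroℤ-true : ∀ {a} → isZeroℤ a ≡ true → a ≡ + 0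
isZeroℤ-true {+ zero} _ = refl

isZeroPoly-true : ∀ p → isZeroPoly p ≡ true → ∀ k → coeff p k ≡ + 0
isZeroPoly-true []      _  k = refl
isZeroPoly-true (a ∷ p) eq k with isZeroℤ a in a≡0 | isZeroPoly p in p≡0
isZeroPoly-true (a ∷ p) eq zero    | true | true = isZeroℤ-true a≡0
isZeroPoly-true (a ∷ p) eq (suc k) | true | true = isZeroPoly-true p p≡0 k

isZeroPoly-false : ∀ p → isZeroPoly p ≡ false → lead p ≢ + 0
isZeroPoly-false (a ∷ p) eq a≡0 with isZeroPoly p in p≡0
isZeroPoly-false (a ∷ p) eq refl | true with () ← eq
... | false = isZeroPoly-false p p≡0 a≡0

-- `deg` gives 0 both for the zero polynomial and for nonzero constants, so degree arguments need
-- this case split.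
zero-or-lead : ∀ p → (∀ k → coeff p k ≡ + 0) ⊎ lead p ≢ + 0
zero-or-lead p with isZeroPoly p in eq
... | true  = inj₁ (isZeroPoly-true p eq)
... | false = inj₂ (isZeroPoly-false p eq)

deg>0⇒lead≢0 : ∀ p → 0 < deg p → lead p ≢ + 0
deg>0⇒lead≢0 (a ∷ p) 0<deg lead≡0 with isZeroPoly p in p≡0
... | false = isZeroPoly-false p p≡0 lead≡0

Vanish-deg : ∀ p → Vanish (suc (deg p)) (coeff p)
Vanish-deg []      k       _ = refl
Vanish-deg (a ∷ p) (suc k) (s≤s deg≤k) with isZeroPoly p in p≡0
... | true  = isZeroPoly-true p p≡0 k
... | false = Vanish-deg p k deg≤k

deg-unique : ∀ p {d} → Vanish (suc d) (coeff p) → coeff p d ≢ + 0 → deg p ≡ d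
deg-unique p {d} vp pd≢0 with ℕₚ.<-cmp (deg p) d | zero-or-lead p
... | tri< deg<d _ _ | _            = contradiction (Vanish-deg p d deg<d) pd≢0
... | tri≈ _ deg≡d _ | _            = deg≡d
... | tri> _ _ d<deg | inj₁ p≡0     = contradiction (p≡0 d) pd≢0
... | tri> _ _ d<deg | inj₂ lead≢0  = contradiction (vp (deg p) d<deg) lead≢0

top≢0 : ∀ p f → lead p ≢ + 0 → lead f ≢ + 0 → (coeff p ⊛ coeff f) (deg p ℕ.+ deg f) ≢ + 0
top≢0 p f lp lf eq =
  [ lp , lf ]′ (ℤₚ.i*j≡0⇒i≡0∨j≡0 (lead p) (trans (sym (⊛-top (Vanish-deg p) (Vanish-deg f))) eq))

deg-* : ∀ p f → lead p ≢ + 0 → lead f ≢ + 0 → deg (p *ₚ f) ≡ deg p ℕ.+ deg f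
deg-* p f lp lf = deg-unique (p *ₚ f)
  (λ k d<k → trans (coeff-* p f k) (Vanish-⊛ (Vanish-deg p) (Vanish-deg f) k d<k))
  (top≢0 p f lp lf ∘ trans (sym (coeff-* p f (deg p ℕ.+ deg f))))

-- Degrees in a Bezout identity

module BezoutDegrees (f g : Poly) (0<m : 0 < deg f) (0<n : 0 < deg g) {r : ℤ} (r≢0 : r ≢ + 0) where

  Bezout : Poly → Poly → Set
  Bezout p q = ∀ k → (coeff p ⊛ coeff f) k ℤ.+ (coeff q ⊛ coeff g) k ≡ r ℤ.* δ 0 k

  lf : lead f ≢ + 0
  lf = deg>0⇒lead≢0 f 0<m

  lg : lead g ≢ + 0
  lg = deg>0⇒lead≢0 g 0<n

  ⊛-zero : ∀ {a} b k → (∀ l → a l ≡ + 0) → (a ⊛ b) k ≡ + 0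
  ⊛-zero b k a≡0 = ∑-zero (suc k) (λ l _ →
    trans (cong (ℤ._* shift l b k) (a≡0 l)) (ℤₚ.*-zeroˡ (shift l b k)))

  constant : ∀ p q → Bezout p q → ∀ k → 0 < k →
    (coeff p ⊛ coeff f) k ℤ.+ (coeff q ⊛ coeff g) k ≡ + 0
  constant p q bezout (suc k) _ = trans (bezout (suc k)) (ℤₚ.*-zeroʳ r)

  cancelˡ : ∀ p q → Bezout p q → ∀ k → 0 < k →
    (coeff p ⊛ coeff f) k ≡ + 0 → (coeff q ⊛ coeff g) k ≡ + 0
  cancelˡ p q bezout k 0<k eq = trans (sym (ℤₚ.+-identityˡ _))
    (trans (cong (ℤ._+ (coeff q ⊛ coeff g) k) (sym eq)) (constant p q bezout k 0<k))

  cancelʳ : ∀ p q → Bezout p q → ∀ k → 0 < k →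
    (coeff q ⊛ coeff g) k ≡ + 0 → (coeff p ⊛ coeff f) k ≡ + 0
  cancelʳ p q bezout k 0<k eq = trans (sym (ℤₚ.+-identityʳ _))
    (trans (cong (ℤ._+_ ((coeff p ⊛ coeff f) k)) (sym eq)) (constant p q bezout k 0<k))

  0<top-p : ∀ p → 0 < deg p ℕ.+ deg f
  0<top-p p = ℕₚ.<-≤-trans 0<m (ℕₚ.m≤n+m (deg f) (deg p))

  0<top-q : ∀ q → 0 < deg q ℕ.+ deg g
  0<top-q q = ℕₚ.<-≤-trans 0<n (ℕₚ.m≤n+m (deg g) (deg q))

  -- Both products vanishing would give `r = 0`. Otherwise, if only one vanishes or the degrees
  -- differ, the top coefficient of the product of larger degree has nothing to cancel it. As `f`
  -- and `g` have positive degree, it lies above the constant term, where the sum is 0.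
  degrees : ∀ p q → Bezout p q → lead p ≢ + 0 × deg p ℕ.+ deg f ≡ deg q ℕ.+ deg g
  degrees p q bezout with zero-or-lead p | zero-or-lead q
  ... | inj₁ p≡0 | inj₁ q≡0 = contradiction
    (trans (sym (ℤₚ.*-identityʳ r)) (trans (sym (bezout 0))
      (cong₂ ℤ._+_ (⊛-zero (coeff f) 0 p≡0) (⊛-zero (coeff g) 0 q≡0)))) r≢0
  ... | inj₁ p≡0 | inj₂ lq = contradiction
    (cancelˡ p q bezout _ (0<top-q q) (⊛-zero (coeff f) _ p≡0)) (top≢0 q g lq lg)
  ... | inj₂ lp | inj₁ q≡0 = contradiction
    (cancelʳ p q bezout _ (0<top-p p) (⊛-zero (coeff g) _ q≡0)) (top≢0 p f lp lf)
  ... | inj₂ lp | inj₂ lq with ℕₚ.<-cmp (deg p ℕ.+ deg f) (deg q ℕ.+ deg g)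
  ... | tri< lt _ _ = contradiction
    (cancelˡ p q bezout _ (0<top-q q) (Vanish-⊛ (Vanish-deg p) (Vanish-deg f) _ lt)) (top≢0 q g lq lg)
  ... | tri≈ _ eq _ = lp , eq
  ... | tri> _ _ gt = contradiction
    (cancelʳ p q bezout _ (0<top-p p) (Vanish-⊛ (Vanish-deg q) (Vanish-deg g) _ gt)) (top≢0 p f lp lf)

-- Divisibility

coprime-* : ∀ {a b c} → Coprime a c → Coprime b c → Coprime (a * b) c
coprime-* {a} {b} ac bc {d} (d∣ab , d∣c) =
  bc (coprime-divisor {d} {a} {b} (λ { (x∣d , x∣a) → ac (x∣a , ∣-trans x∣d d∣c) }) d∣ab , d∣c)

coprime-^ : ∀ {a c} k → Coprime a c → Coprime (a ^ k) c
coprime-^ zero    ac (d∣1 , _) = ∣1⇒≡1 d∣1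
coprime-^ {a} {c} (suc k) ac = coprime-* {a} {a ^ k} {c} ac (coprime-^ k ac)

^-distribʳ-* : ∀ k a b → (a * b) ^ k ≡ a ^ k * b ^ k
^-distribʳ-* zero    a b = refl
^-distribʳ-* (suc k) a b = trans (cong (a * b *_) (^-distribʳ-* k a b))
  (ℕₚ.[m*n]*[o*p]≡[m*o]*[n*p] a b (a ^ k) (b ^ k))

-- Both multiples of `x` contain `gcd a c ^ k * b`; the remaining factors are powers of
-- `a / gcd a c` and `c / gcd a c`, which are coprime. `a ≢ 0` makes the gcd a legitimate divisor.
∣gcd^ : ∀ {x} a c k b → a ≢ 0 → x ∣ a ^ k * b → x ∣ c ^ k * b → x ∣ gcd a c ^ k * b
∣gcd^ {x} a c k b a≢0 x∣a x∣c = coprime-factors {m = a′ ^ k} {n = c′ ^ k}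
  (coprime-^ k (Coprimality.sym (coprime-^ k (Coprimality.sym (coprime-/gcd a c)))))
  (subst (x ∣_) (split a (gcd[m,n]∣m a c)) x∣a , subst (x ∣_) (split c (gcd[m,n]∣n a c)) x∣c)
  where
  instance
    _ = ℕ.≢-nonZero (gcd[m,n]≢0 a c (inj₁ a≢0))
  a′ c′ : ℕ
  a′ = a / gcd a c
  c′ = c / gcd a c
  split : ∀ u → gcd a c ∣ u → u ^ k * b ≡ (u / gcd a c) ^ k * (gcd a c ^ k * b)
  split u d∣u = trans (cong (λ v → v ^ k * b) (sym (m/n*n≡m d∣u)))
    (trans (cong (_* b) (^-distribʳ-* k (u / gcd a c) (gcd a c)))
           (ℕₚ.*-assoc ((u / gcd a c) ^ k) (gcd a c ^ k) b))

^-monoʳ-∣ : ∀ r {m n} → m ≤ n → r ^ m ∣ r ^ n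
^-monoʳ-∣ r {m} {n} m≤n = subst (λ k → r ^ m ∣ r ^ k) (ℕₚ.m+[n∸m]≡n m≤n)
  (subst (r ^ m ∣_) (sym (ℕₚ.^-distribˡ-+-* r m (n ℕ.∸ m))) (m∣m*n (r ^ (n ℕ.∸ m))))

abs-^ : ∀ a k → ∣ a ℤ.^ k ∣ ≡ ∣ a ∣ ^ k
abs-^ a zero    = refl
abs-^ a (suc k) = trans (ℤₚ.abs-* a (a ℤ.^ k)) (cong (∣ a ∣ *_) (abs-^ a k))

abs-divides : ∀ a c x r k l → a ℤ.^ k ℤ.* (+ r) ℤ.^ l ≡ c ℤ.* x →
  ∣ x ∣ ∣ ∣ a ∣ ^ k * r ^ l
abs-divides a c x r k l eq = divides ∣ c ∣ (begin
  ∣ a ∣ ^ k * r ^ l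
    ≡⟨ cong₂ _*_ (abs-^ a k) (abs-^ (+ r) l) ⟨
  ∣ a ℤ.^ k ∣ * ∣ (+ r) ℤ.^ l ∣
    ≡⟨ ℤₚ.abs-* (a ℤ.^ k) ((+ r) ℤ.^ l) ⟨
  ∣ a ℤ.^ k ℤ.* (+ r) ℤ.^ l ∣
    ≡⟨ cong ∣_∣ eq ⟩
  ∣ c ℤ.* x ∣
    ≡⟨ ℤₚ.abs-* c x ⟩
  ∣ c ∣ * ∣ x ∣ ∎)
  where open ≡-Reasoning

-- The two one-sided divisibilities

module BezoutDivisibility (f g : Poly) (0<m : 0 < deg f) (0<n : 0 < deg g) (r : ℕ) (0<r : 0 < r)
  (p q : Poly) (comb : (p *ₚ f +ₚ q *ₚ g) ≈ₚ const (+ r)) where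

  open BezoutDegrees f g 0<m 0<n {+ r} (ℕₚ.<⇒≢ 0<r ∘ sym ∘ ℤₚ.+-injective)

  m n j : ℕ
  m = deg f
  n = deg g
  j = deg (p *ₚ f)

  const-δ : ∀ k → coeff (const (+ r)) k ≡ + r ℤ.* δ 0 k
  const-δ zero    = sym (ℤₚ.*-identityʳ (+ r))
  const-δ (suc k) = sym (ℤₚ.*-zeroʳ (+ r))

  bezout : Bezout p q
  bezout k = begin
    (coeff p ⊛ coeff f) k ℤ.+ (coeff q ⊛ coeff g) k ≡⟨ cong₂ ℤ._+_ (coeff-* p f k) (coeff-* q g k) ⟨
    coeff (p *ₚ f) k ℤ.+ coeff (q *ₚ g) k           ≡⟨ coeff-+ (p *ₚ f) (q *ₚ g) k ⟨
    coeff (p *ₚ f +ₚ q *ₚ g) k                      ≡⟨ comb k ⟩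
    coeff (const (+ r)) k                           ≡⟨ const-δ k ⟩
    + r ℤ.* δ 0 k                                   ∎
    where open ≡-Reasoning

  j≡m+p : j ≡ m ℕ.+ deg p
  j≡m+p with lp , _ ← degrees p q bezout = trans (deg-* p f lp lf) (ℕₚ.+-comm (deg p) m)

  j≡n+q : j ≡ n ℕ.+ deg q
  j≡n+q with lp , eq ← degrees p q bezout =
    trans (deg-* p f lp lf) (trans eq (ℕₚ.+-comm (deg q) n))

  R∣lead-f : R f g ∣ ∣ lead f ∣ ^ j * r ^ m
  R∣lead-f = abs-divides (lead f) c (Res f g) r j m (begin
    lead f ℤ.^ j ℤ.* (+ r) ℤ.^ m
      ≡⟨ cong (λ k → lead f ℤ.^ k ℤ.* (+ r) ℤ.^ m) j≡n+q ⟩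
    lead f ℤ.^ (n ℕ.+ deg q) ℤ.* (+ r) ℤ.^ m
      ≡⟨ proj₂ divisor ⟩
    c ℤ.* resultant m n (coeff f) (coeff g)
      ≡⟨ cong (ℤ._*_ c) (Res≡resultant f g) ⟨
    c ℤ.* Res f g ∎)
    where
    open ≡-Reasoning
    divisor : ∃[ c ] lead f ℤ.^ (n ℕ.+ deg q) ℤ.* (+ r) ℤ.^ m ≡ c ℤ.* resultant m n (coeff f) (coeff g)
    divisor = BezoutRows.resultant-divides m n (deg q) (deg p) (coeff f) (coeff g) (coeff p) (coeff q) (+ r)
      (Vanish-deg f) (Vanish-deg g) (Vanish-deg p) (Vanish-deg q) (trans (sym j≡n+q) j≡m+p) bezout lg
    c : ℤ
    c = proj₁ divisor

  -- Exchanging the roles of `(f, p)` and `(g, q)` yields a multiple of Res(g, f); the factor from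
  -- `resultant-swap` joins the quotient.
  R∣lead-g : R f g ∣ ∣ lead g ∣ ^ j * r ^ n
  R∣lead-g = abs-divides (lead g) (c ℤ.* proj₁ swapped) (Res f g) r j n (begin
    lead g ℤ.^ j ℤ.* (+ r) ℤ.^ n
      ≡⟨ cong (λ k → lead g ℤ.^ k ℤ.* (+ r) ℤ.^ n) j≡m+p ⟩
    lead g ℤ.^ (m ℕ.+ deg p) ℤ.* (+ r) ℤ.^ n
      ≡⟨ proj₂ divisor ⟩
    c ℤ.* resultant n m (coeff g) (coeff f)
      ≡⟨ cong (ℤ._*_ c) (trans (proj₂ swapped) (cong (ℤ._*_ (proj₁ swapped)) (sym (Res≡resultant f g)))) ⟩
    c ℤ.* (proj₁ swapped ℤ.* Res f g)
      ≡⟨ ℤₚ.*-assoc c (proj₁ swapped) (Res f g) ⟨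
    c ℤ.* proj₁ swapped ℤ.* Res f g ∎)
    where
    open ≡-Reasoning
    divisor : ∃[ c ] lead g ℤ.^ (m ℕ.+ deg p) ℤ.* (+ r) ℤ.^ n ≡ c ℤ.* resultant n m (coeff g) (coeff f)
    divisor = BezoutRows.resultant-divides n m (deg p) (deg q) (coeff g) (coeff f) (coeff q) (coeff p) (+ r)
      (Vanish-deg g) (Vanish-deg f) (Vanish-deg q) (Vanish-deg p) (trans (sym j≡m+p) j≡n+q)
      (λ k → trans (ℤₚ.+-comm ((coeff q ⊛ coeff g) k) _) (bezout k)) lf
    c : ℤ
    c = proj₁ divisor
    swapped : ∃[ c ] resultant n m (coeff g) (coeff f) ≡ c ℤ.* resultant m n (coeff f) (coeff g)
    swapped = resultant-swap m n (coeff f) (coeff g)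

theorem4p1 : (f g : Poly) → 0 < deg f → 0 < deg g → Res f g ≢ + 0 →
    (r : ℕ) → IsMinComb f g r →
    (p q : Poly) → (p *ₚ f +ₚ q *ₚ g) ≈ₚ const (+ r) →
    (R f g ∣ (gcd ∣ lead f ∣ ∣ lead g ∣ ^ deg (p *ₚ f)) * r ^ (deg f ⊔ deg g))
    × (lead f ≡ + 1 → lead g ≡ + 1 → R f g ∣ r ^ (deg f ⊓ deg g))
theorem4p1 f g 0<m 0<n _ r (0<r , _) p q comb = general , monic
  where
  open BezoutDivisibility f g 0<m 0<n r 0<r p q comb

  general : R f g ∣ (gcd ∣ lead f ∣ ∣ lead g ∣ ^ j) * r ^ (m ⊔ n)
  -- `∣gcd^` needs one common cofactor `b`, so `r ^ m` and `r ^ n` are both enlarged to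
  -- `r ^ (m ⊔ n)`.
  general = ∣gcd^ ∣ lead f ∣ ∣ lead g ∣ j (r ^ (m ⊔ n)) (deg>0⇒lead≢0 f 0<m ∘ ℤₚ.∣i∣≡0⇒i≡0)
    (∣-trans R∣lead-f (*-monoʳ-∣ (∣ lead f ∣ ^ j) (^-monoʳ-∣ r (ℕₚ.m≤m⊔n m n))))
    (∣-trans R∣lead-g (*-monoʳ-∣ (∣ lead g ∣ ^ j) (^-monoʳ-∣ r (ℕₚ.m≤n⊔m m n))))

  drop-lead : ∀ a k → a ≡ + 1 → R f g ∣ ∣ a ∣ ^ j * r ^ k → R f g ∣ r ^ k
  drop-lead a k refl = subst (R f g ∣_) (trans (cong (_* r ^ k) (ℕₚ.^-zeroˡ j)) (ℕₚ.*-identityˡ (r ^ k)))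

  monic : lead f ≡ + 1 → lead g ≡ + 1 → R f g ∣ r ^ (m ⊓ n)
  -- The minimum is one of `m` and `n`, and each has its own divisibility: `m` the one for `lead f`,
  -- `n` the one for `lead g`.
  monic lf≡1 lg≡1 with ℕₚ.⊓-sel m n
  ... | inj₁ m⊓n≡m = subst (λ k → R f g ∣ r ^ k) (sym m⊓n≡m) (drop-lead (lead f) m lf≡1 R∣lead-f)
  ... | inj₂ m⊓n≡n = subst (λ k → R f g ∣ r ^ k) (sym m⊓n≡n) (drop-lead (lead g) n lg≡1 R∣lead-g)
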